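{- $gr^3_2(B_{14})=23$.
   Context: $K_n$ is the complete graph of order $n$. The book $B_n:=K_2+nK_1$ (graph join) is the graph on $n+2$ vertices consisting of an edge $xy$ (the spine) together with $n$ further, pairwise non-adjacent vertices (the pages), each adjacent to both $x$ and $y$. A $t$-coloring of $K_p$ is a map $f:E(K_p)\to\{1,\dots,t\}$, not assumed surjective. A Gallai $t$-coloring is a $t$-coloring with no rainbow triangle, i.e. there are no three vertices $x,y,z$ such that $f(xy),f(xz),f(yz)$ are pairwise distinct. For $1\le s<t$ and a graph $G$, the weakened Gallai-Ramsey number $gr^t_s(G)$ is the least $p\in\mathbb{N}$ such that every Gallai $t$-coloring of $K_p$ contains a (not necessarily induced) subgraph isomorphic to $G$ whose edges use at most $s$ colors. -}

module Defs where

open import Data.Nat using (ℕ; _≤_)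
open import Data.Fin using (Fin)
open import Data.Fin.Subset using (Subset; _∈_; ∣_∣)
open import Data.Sum using (_⊎_; inj₁; inj₂)
open import Data.Product using (Σ-syntax; _×_)
open import Data.Empty using (⊥)
open import Data.Unit using (⊤; tt)
open import Relation.Nullary using (¬_)
open import Relation.Binary.Definitions using (Symmetric; Irreflexive)
open import Relation.Binary.PropositionalEquality using (_≡_; _≢_; refl; ≢-sym)
open import Function.Definitions using (Injective)

record Graph : Set₁ where
  field
    Vertex : Set
    Adj    : Vertex → Vertex → Set
    sym    : Symmetric Adj
    irrefl : Irreflexive _≡_ Adj

open Graph public using (Vertex; Adj)

K : ℕ → Graph
K n = record
  { Vertex = Fin n
  ; Adj    = _≢_
  ; sym    = ≢-sym
  ; irrefl = λ x≡y x≢y → x≢y x≡y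
  }

-- n K₁, the disjoint union of n isolated vertices.
Isolated : ℕ → Graph
Isolated n = record
  { Vertex = Fin n
  ; Adj    = λ _ _ → ⊥
  ; sym    = λ ()
  ; irrefl = λ _ ()
  }

module _ (G H : Graph) where

  JoinAdj : Vertex G ⊎ Vertex H → Vertex G ⊎ Vertex H → Set
  JoinAdj (inj₁ u) (inj₁ v) = Adj G u v
  JoinAdj (inj₁ _) (inj₂ _) = ⊤
  JoinAdj (inj₂ _) (inj₁ _) = ⊤
  JoinAdj (inj₂ u) (inj₂ v) = Adj H u v

  joinAdj-sym : Symmetric JoinAdj
  joinAdj-sym {inj₁ _} {inj₁ _} uv = Graph.sym G uv
  joinAdj-sym {inj₁ _} {inj₂ _} _  = tt
  joinAdj-sym {inj₂ _} {inj₁ _} _  = tt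
  joinAdj-sym {inj₂ _} {inj₂ _} uv = Graph.sym H uv

  joinAdj-irrefl : Irreflexive _≡_ JoinAdj
  joinAdj-irrefl {inj₁ _} refl uu = Graph.irrefl G refl uu
  joinAdj-irrefl {inj₂ _} refl uu = Graph.irrefl H refl uu

  join : Graph
  join = record
    { Vertex = Vertex G ⊎ Vertex H
    ; Adj    = JoinAdj
    ; sym    = λ {x} {y} → joinAdj-sym {x} {y}
    ; irrefl = λ {x} {y} → joinAdj-irrefl {x} {y}
    }

Book : ℕ → Graph
Book n = join (K 2) (Isolated n)

-- A t-coloring of E(K_p), given as a symmetric function on pairs of vertices.
-- The values on the diagonal are irrelevant: only pairs of distinct vertices
-- are ever inspected below.
record Coloring (t p : ℕ) : Set where
  field
    color     : Fin p → Fin p → Fin t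
    color-sym : ∀ x y → color x y ≡ color y x

open Coloring public

RainbowTriangle : ∀ {t p} → Coloring t p → Fin p → Fin p → Fin p → Set
RainbowTriangle f x y z =
  (x ≢ y × x ≢ z × y ≢ z) ×
  (color f x y ≢ color f x z × color f x y ≢ color f y z × color f x z ≢ color f y z)

IsGallai : ∀ {t p} → Coloring t p → Set
IsGallai f = ∀ x y z → ¬ RainbowTriangle f x y z

-- A not necessarily induced copy of G in K_p is an injection of its vertices;
-- C is a set of at most s colors containing the colors of all its edges.
ContainsCopyInAtMost : ∀ {t p} → ℕ → Graph → Coloring t p → Set
ContainsCopyInAtMost {t} {p} s G f =
  Σ[ φ ∈ (Vertex G → Fin p) ] Injective _≡_ _≡_ φ ×
  (Σ[ C ∈ Subset t ] ∣ C ∣ ≤ s × (∀ u v → Adj G u v → color f (φ u) (φ v) ∈ C))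

GallaiArrows : ℕ → ℕ → Graph → ℕ → Set
GallaiArrows t s G p = (f : Coloring t p) → IsGallai f → ContainsCopyInAtMost s G f

IsLeast : (ℕ → Set) → ℕ → Set
IsLeast P p = P p × (∀ q → P q → p ≤ q)

-- gr^t_s(G) = p, for 1 ≤ s < t.  A relation rather than a function, since the
-- existence of the minimum is part of the assertion.
IsWeakenedGallaiRamsey : (t s : ℕ) → Graph → ℕ → Set
IsWeakenedGallaiRamsey t s G = IsLeast (GallaiArrows t s G)

{-# OPTIONS --safe #-}
module Submission where

-- Negating the claim for K₂₃: for every edge xy and every colour c other than that of xy, the
-- c-neighbourhoods of x and y have a union of size at least 8.  Some colour t of a Gallai colouring
-- is disconnected, and any two t-components are joined in a single colour.  Each of five components
-- would need too many vertices; with at most four, either the reduced 2-colouring has a monochromatic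
-- cut or it is a path on four vertices with complementary path, and then comparing, for each
-- component, a t-edge inside it with the one other component seen in some colour contradicts
-- the number of vertices.  A monochromatic cut has a side of at most 11 vertices; if that side had
-- two vertices it would have at least 10, and the Ramsey number r(B₂, B₂) = 10 would give a book
-- inside it that violates the assumption.  So that side is a single vertex, an apex.  Without the
-- apex every vertex has degree at least 8 in the two other colours, which forbids cuts, so the
-- component argument applies to the remaining 22 vertices.
-- For the lower bound, join an apex to a blown-up pentagon on 21 vertices.

open import Defs
open import Data.Bool using (Bool; true; false; not; _∧_; _∨_; if_then_else_)
open import Data.Bool.Properties using (∨-zeroʳ)
open import Data.Nat as ℕ using (ℕ; zero; suc; _+_; _*_; _≤_; _<_; z≤n; s≤s; s≤s⁻¹; ∣_-_∣)
open import Data.Nat.Properties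
  using (≤-refl; ≤-reflexive; ≤-trans; ≮⇒≥; ≰⇒>; <⇒≱; m≤n+m; +-mono-≤;
         +-monoʳ-≤; +-monoˡ-≤; +-identityʳ; +-comm; +-cancelˡ-≤; *-monoʳ-≤; +-suc; ∣-∣-comm;
         +-0-commutativeMonoid; module ≤-Reasoning)
open import Data.Nat.DivMod using (_mod_)
open import Data.Nat.Solver using (module +-*-Solver)
open import Data.Fin using (Fin; zero; suc; toℕ; punchIn; inject≤)
open import Data.Fin.Patterns using (0F; 1F; 2F; 3F; 4F)
open import Data.Fin.Properties
  using (_≟_; any?; all?; suc-injective; punchIn-injective; punchInᵢ≢i;
         inject≤-injective; 0≢1+n)
open import Data.Fin.Subset using (Subset; _∈_; ⊤; ∣_∣; ⁅_⁆; ∁)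
open import Data.Fin.Subset.Properties
  using (_∈?_; x∈⁅y⁆⇒x≡y; x∉p⇒x∈∁p; ∣∁p∣≡n∸∣p∣; ∣⁅x⁆∣≡1; p⊆q⇒∣p∣≤∣q∣)
open import Data.List using (List; []; _∷_; map; length)
open import Data.List.Relation.Unary.All as All using (All; []; _∷_)
open import Data.List.Relation.Unary.All.Properties using (¬Any⇒All¬)
open import Data.List.Relation.Unary.AllPairs as AllPairs using (AllPairs; []; _∷_; allPairs?)
import Data.List.Relation.Unary.AllPairs.Properties as AllPairs
open import Data.List.Relation.Unary.Any as Any using (Any; here; there)
open import Data.Nat.ListAction using (sum)
open import Data.Maybe using (Maybe; just; nothing)
open import Data.Maybe.Properties using (just-injective)
open import Data.Product using (Σ-syntax; ∃; ∃₂; ∃-syntax; _×_; _,_; proj₁; proj₂)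
open import Data.Sum using (_⊎_; inj₁; inj₂; [_,_]′)
open import Data.Sum.Properties using (inj₂-injective)
open import Data.Empty using (⊥; ⊥-elim)
open import Data.Unit using (tt)
open import Function using (_∘_; id; case_of_)
open import Function.Definitions using (Injective)
open import Relation.Nullary using (¬_; Dec; yes; no; does; contradiction)
open import Relation.Nullary.Decidable
  using (¬?; _×-dec_; _→-dec_; _⊎-dec_; from-yes; from-no; dec-true; dec-false; decidable-stable)
open import Relation.Binary.PropositionalEquality
  using (_≡_; _≢_; refl; sym; trans; cong; cong₂; subst; subst₂; ≢-sym; module ≡-Reasoning)
open import Algebra.Properties.CommutativeMonoid.Sum +-0-commutativeMonoid as Sum
  using (sum-remove; ∑-distrib-+)

private
  variable
    m n t : ℕ

-- Counting with Boolean predicates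

⟦_⟧ : Bool → ℕ
⟦ b ⟧ = if b then 1 else 0

# : (Fin n → Bool) → ℕ
# p = Sum.sum (⟦_⟧ ∘ p)

weight : List (Fin n → Bool) → Fin n → ℕ
weight ps z = sum (map (λ p → ⟦ p z ⟧) ps)

total : List (Fin n → Bool) → ℕ
total ps = sum (map # ps)

∑-weight : (ps : List (Fin n → Bool)) → Sum.sum (weight ps) ≡ total ps
∑-weight {n} [] = Sum.sum-replicate-zero n
∑-weight (p ∷ ps) = trans (∑-distrib-+ (⟦_⟧ ∘ p) (weight ps)) (cong (# p +_) (∑-weight ps))

∑-mono : (g h : Fin n → ℕ) → (∀ z → g z ≤ h z) → Sum.sum g ≤ Sum.sum h
∑-mono {zero}  g h g≤h = z≤n
∑-mono {suc n} g h g≤h = +-mono-≤ (g≤h zero) (∑-mono (g ∘ suc) (h ∘ suc) (g≤h ∘ suc))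

-- Double counting: a sum of set sizes equals the sum, over the vertices, of the number of sets that
-- contain the vertex. All size inequalities below are reduced in this way to a check at a single
-- vertex.
total-mono : (ps qs : List (Fin n → Bool)) → (∀ z → weight ps z ≤ weight qs z) → total ps ≤ total qs
total-mono ps qs ps≤qs = subst₂ _≤_ (∑-weight ps) (∑-weight qs) (∑-mono _ _ ps≤qs)

⟦⟧≤1 : ∀ b → ⟦ b ⟧ ≤ 1
⟦⟧≤1 false = z≤n
⟦⟧≤1 true  = ≤-refl

⟦⟧-mono : ∀ {a b} → (a ≡ true → b ≡ true) → ⟦ a ⟧ ≤ ⟦ b ⟧
⟦⟧-mono {false} _   = z≤n
⟦⟧-mono {true}  a⇒b rewrite a⇒b refl = ≤-refl

⟦∨⟧ : ∀ a b → ⟦ a ∨ b ⟧ ≤ ⟦ a ⟧ + ⟦ b ⟧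
⟦∨⟧ false b = ≤-refl
⟦∨⟧ true  b = s≤s z≤n

≢true⇒false : ∀ {b} → b ≢ true → b ≡ false
≢true⇒false {false} _ = refl
≢true⇒false {true}  b≢true = contradiction refl b≢true

true-false : ∀ {A : Set} {b} → b ≡ true → b ≡ false → A
true-false refl ()

∨-true : ∀ a {b} → a ∨ b ≡ true → a ≡ true ⊎ b ≡ true
∨-true true  _ = inj₁ refl
∨-true false e = inj₂ e

all-members : Fin n → Bool
all-members _ = true

#-all : ∀ n → # (all-members {n}) ≡ n
#-all zero    = refl
#-all (suc n) = cong suc (#-all n)

is : Fin n → Fin n → Bool
is x z = does (x ≟ z)

#-none : (p : Fin n → Bool) → (∀ z → p z ≡ false) → # p ≡ 0
#-none {zero}  p none = refl
#-none {suc n} p none rewrite none zero = #-none (p ∘ suc) (none ∘ suc)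

#-is : (x : Fin n) → # (is x) ≡ 1
#-is {suc n} zero    = cong suc (#-none (is {suc n} zero ∘ suc) (λ _ → refl))
#-is {suc n} (suc x) = #-is x

enumerate : ∀ m (p : Fin n → Bool) → m ≤ # p →
            Σ[ φ ∈ (Fin m → Fin n) ] Injective _≡_ _≡_ φ × (∀ i → p (φ i) ≡ true)
enumerate zero p _ = (λ ()) , (λ { {()} }) , λ ()
enumerate {suc n} (suc m) p m<#p with p zero in p₀
... | false = let φ , inj , φ∈p = enumerate (suc m) (p ∘ suc) m<#p
              in suc ∘ φ , inj ∘ suc-injective , φ∈p
enumerate {suc n} (suc m) p (s≤s m≤#p) | true = φ′ , inj′ , φ′∈p
  where
  rest = enumerate m (p ∘ suc) m≤#p
  φ′ : Fin (suc m) → Fin (suc n)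
  φ′ zero    = zero
  φ′ (suc i) = suc (proj₁ rest i)
  inj′ : Injective _≡_ _≡_ φ′
  inj′ {zero}  {zero}  _ = refl
  inj′ {suc i} {suc j} e = cong suc (proj₁ (proj₂ rest) (suc-injective e))
  φ′∈p : ∀ i → p (φ′ i) ≡ true
  φ′∈p zero    = p₀
  φ′∈p (suc i) = proj₂ (proj₂ rest) i

injection⇒≤# : ∀ {m} (p : Fin n → Bool) (φ : Fin m → Fin n) → Injective _≡_ _≡_ φ →
               (∀ i → p (φ i) ≡ true) → m ≤ # p
injection⇒≤# {m = zero}  p φ inj φ∈p = z≤n
injection⇒≤# {n = n} {m = suc m} p φ inj φ∈p = begin
  suc m                             ≡⟨ cong (_+ m) (#-is (φ zero)) ⟨
  # (is (φ zero)) + m               ≤⟨ +-monoʳ-≤ (# (is (φ zero)))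
                                         (injection⇒≤# p′ (φ ∘ suc) (suc-injective ∘ inj) φ∈p′) ⟩
  # (is (φ zero)) + # p′            ≡⟨ cong (# (is (φ zero)) +_) (+-identityʳ _) ⟨
  total (is (φ zero) ∷ p′ ∷ [])     ≤⟨ total-mono (is (φ zero) ∷ p′ ∷ []) (p ∷ []) pointwise ⟩
  # p + 0                           ≡⟨ +-identityʳ _ ⟩
  # p                               ∎
  where
  open ≤-Reasoning
  p′ : Fin n → Bool
  p′ z = not (is (φ zero) z) ∧ p z
  φ∈p′ : ∀ i → p′ (φ (suc i)) ≡ true
  φ∈p′ i rewrite dec-false (φ zero ≟ φ (suc i)) (0≢1+n ∘ inj) = φ∈p (suc i)
  pointwise : ∀ z → weight (is (φ zero) ∷ p′ ∷ []) z ≤ weight (p ∷ []) z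
  pointwise z with φ zero ≟ z
  ... | yes refl rewrite φ∈p zero = ≤-refl
  ... | no _ = ≤-refl

#-punchIn : (x : Fin (suc n)) (p : Fin (suc n) → Bool) → # p ≡ ⟦ p x ⟧ + # (p ∘ punchIn x)
#-punchIn x p = sum-remove {i = x} (⟦_⟧ ∘ p)

-- Restrictions and components of a colour

restrict : (φ : Fin m → Fin n) → Coloring t n → Coloring t m
restrict φ f = record
  { color     = λ x y → color f (φ x) (φ y)
  ; color-sym = λ x y → color-sym f (φ x) (φ y)
  }

restrict-gallai : (φ : Fin m → Fin n) → Injective _≡_ _≡_ φ → (f : Coloring t n) →
                  IsGallai f → IsGallai (restrict φ f)
restrict-gallai φ inj f gallai x y z ((x≢y , x≢z , y≢z) , rainbow) =
  gallai (φ x) (φ y) (φ z) ((x≢y ∘ inj , x≢z ∘ inj , y≢z ∘ inj) , rainbow)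

-- No paths are stored: `connected` is an induction principle, by which whatever is invariant along
-- the edges of colour `c` is constant on a component.
record Components (f : Coloring t n) (c : Fin t) : Set₁ where
  field
    label     : Fin n → Fin n
    edge      : ∀ x y → color f x y ≡ c → label x ≡ label y
    connected : ∀ {A : Set} (g : Fin n → A) → (∀ x y → x ≢ y → color f x y ≡ c → g x ≡ g y) →
                ∀ x y → label x ≡ label y → g x ≡ g y

-- Vertices are added one at a time. The new vertex 0 merges all components that it touches into one
-- with label `zero`; the others keep their labels, shifted by one.
components : (f : Coloring t n) (c : Fin t) → Components f c
components {n = zero}  f c = record { label = id ; edge = λ () ; connected = λ _ _ () }
components {n = suc n} f c = record { label = label′ ; edge = edge′ ; connected = connected′ }
  where
  open Components (components (restrict suc f) c)

  touched? : ∀ x → Dec (∃[ y ] label y ≡ label x × color f zero (suc y) ≡ c)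
  touched? x = any? λ y → label y ≟ label x ×-dec color f zero (suc y) ≟ c

  label′ : Fin (suc n) → Fin (suc n)
  label′ zero    = zero
  label′ (suc x) = if does (touched? x) then zero else suc (label x)

  label′-touched : ∀ x → color f zero (suc x) ≡ c → label′ (suc x) ≡ zero
  label′-touched x e rewrite dec-true (touched? x) (x , refl , e) = refl

  label′-cong : ∀ x y → label x ≡ label y → label′ (suc x) ≡ label′ (suc y)
  label′-cong x y e rewrite e = refl

  edge′ : ∀ x y → color f x y ≡ c → label′ x ≡ label′ y
  edge′ zero    zero    _ = refl
  edge′ zero    (suc y) e = sym (label′-touched y e)
  edge′ (suc x) zero    e = label′-touched x (trans (color-sym f zero (suc x)) e)
  edge′ (suc x) (suc y) e = label′-cong x y (edge x y e)

  connected′ : ∀ {A : Set} (g : Fin (suc n) → A) →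
               (∀ x y → x ≢ y → color f x y ≡ c → g x ≡ g y) →
               ∀ x y → label′ x ≡ label′ y → g x ≡ g y
  connected′ g closed = λ
    { zero    zero    _ → refl
    ; zero    (suc y) e → via y (sym e)
    ; (suc x) zero    e → sym (via x e)
    ; (suc x) (suc y) e → both x y e
    }
    where
    below : ∀ x y → label x ≡ label y → g (suc x) ≡ g (suc y)
    below = connected (g ∘ suc) (λ x y x≢y → closed (suc x) (suc y) (x≢y ∘ suc-injective))

    via : ∀ x → label′ (suc x) ≡ zero → g zero ≡ g (suc x)
    via x e with touched? x
    ... | yes (y , ly≡lx , e′) = trans (closed zero (suc y) 0≢1+n e′) (below y x ly≡lx)
    via x () | no _

    both : ∀ x y → label′ (suc x) ≡ label′ (suc y) → g (suc x) ≡ g (suc y)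
    both x y e with touched? x in tx | touched? y in ty
    ... | yes _ | yes _ = trans (sym (via x (cong (if_then zero else suc (label x)) (cong does tx))))
                                (via y (cong (if_then zero else suc (label y)) (cong does ty)))
    ... | no _  | no _  = below x y (suc-injective e)
    both x y () | yes _ | no _
    both x y () | no _  | yes _

-- A disconnected colour

abstract
  third : (a b : Fin 3) → ∃[ c ] c ≢ a × c ≢ b
  third = from-yes (all? {3} λ a → all? {3} λ b → any? {3} λ c → ¬? (c ≟ a) ×-dec ¬? (c ≟ b))

  one-of-two : (t a b c : Fin 3) → a ≢ b → a ≢ t → b ≢ t → c ≢ t → c ≡ a ⊎ c ≡ b
  one-of-two = from-yes (all? {3} λ t → all? {3} λ a → all? {3} λ b → all? {3} λ c →
    ¬? (a ≟ b) →-dec (¬? (a ≟ t) →-dec (¬? (b ≟ t) →-dec (¬? (c ≟ t) →-dec (c ≟ a ⊎-dec c ≟ b)))))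

gallai-triangle : (f : Coloring t n) → IsGallai f → ∀ {x y z} → x ≢ y → x ≢ z → y ≢ z →
                  color f x y ≢ color f x z →
                  color f y z ≡ color f x y ⊎ color f y z ≡ color f x z
gallai-triangle f gallai {x} {y} {z} x≢y x≢z y≢z xy≢xz
  with color f y z ≟ color f x y | color f y z ≟ color f x z
... | yes e | _     = inj₁ e
... | no _  | yes e = inj₂ e
... | no ≢₁ | no ≢₂ = contradiction ((x≢y , x≢z , y≢z) , xy≢xz , ≢-sym ≢₁ , ≢-sym ≢₂) (gallai x y z)

module _ (f : Coloring t n) (gallai : IsGallai f) {c : Fin t} (C : Components f c) where
  open Components C

  -- If zz′ has colour `c` and y lies in another component, then neither zy nor z′y has colour `c`,
  -- so the triangle can avoid being rainbow only if these two agree. This equality propagates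
  -- through the component.
  outside-colour : ∀ x x′ y → label x ≡ label x′ → label x ≢ label y → color f x y ≡ color f x′ y
  outside-colour x x′ y lx≡lx′ lx≢ly = just-injective (trans (sym (g-outside x lx≢ly))
    (trans (connected g closed x x′ lx≡lx′) (g-outside x′ (lx≢ly ∘ trans lx≡lx′))))
    where
    -- The component of `y` itself gets the default value `nothing`, so that `g` is invariant along
    -- all edges of colour `c`.
    g : Fin n → Maybe (Fin t)
    g z = if does (label z ≟ label y) then nothing else just (color f z y)

    g-outside : ∀ z → label z ≢ label y → g z ≡ just (color f z y)
    g-outside z lz≢ly rewrite dec-false (label z ≟ label y) lz≢ly = refl

    closed : ∀ z z′ → z ≢ z′ → color f z z′ ≡ c → g z ≡ g z′
    closed z z′ z≢z′ zz′≡c with edge z z′ zz′≡c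
    ... | lz≡lz′ rewrite sym lz≡lz′ with label z ≟ label y
    ... | yes _ = refl
    ... | no lz≢ly = cong just (sym same)
      where
      lz′≢ly : label z′ ≢ label y
      lz′≢ly = lz≢ly ∘ trans lz≡lz′
      same : color f z′ y ≡ color f z y
      same with gallai-triangle f gallai z≢z′ (lz≢ly ∘ cong label) (lz′≢ly ∘ cong label)
                  (λ e → lz≢ly (edge z y (trans (sym e) zz′≡c)))
      ... | inj₁ e = contradiction (edge z′ y (trans e zz′≡c)) lz′≢ly
      ... | inj₂ e = e

  between-components : ∀ {u x v y} → label u ≡ label x → label v ≡ label y → label x ≢ label y →
                       color f u v ≡ color f x y
  between-components {u} {x} {v} {y} lu≡lx lv≡ly lx≢ly = begin
    color f u v  ≡⟨ outside-colour u x v lu≡lx (λ e → lx≢ly (trans (sym lu≡lx) (trans e lv≡ly))) ⟩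
    color f x v  ≡⟨ color-sym f x v ⟩
    color f v x  ≡⟨ outside-colour v y x lv≡ly (λ e → lx≢ly (sym (trans (sym lv≡ly) e))) ⟩
    color f y x  ≡⟨ color-sym f y x ⟩
    color f x y  ∎
    where open ≡-Reasoning

Disconnected : Coloring t n → Fin t → Set
Disconnected f c = ∃₂ λ x y → label x ≢ label y
  where open Components (components f c)

-- Extended by `false` at the new vertex 0, the predicate `p` is invariant along the edges of colour
-- `c`, and it separates `suc x` from 0.
disconnected-at : (f : Coloring t (suc n)) (c : Fin t) (p : Fin n → Bool) (x : Fin n) → p x ≡ true →
                  (∀ u v → p u ≡ true → p v ≡ false → color f (suc u) (suc v) ≢ c) →
                  (∀ u → p u ≡ true → color f zero (suc u) ≢ c) →
                  Disconnected f c
disconnected-at {t} {n} f c p x x∈p leave-p meet-zero = suc x , zero , λ e → true-false x∈p (connected g closed (suc x) zero e)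
  where
  open Components (components f c)

  g : Fin (suc n) → Bool
  g zero    = false
  g (suc u) = p u

  closed : ∀ u v → u ≢ v → color f u v ≡ c → g u ≡ g v
  closed zero    zero    _ _ = refl
  closed zero    (suc v) _ e = sym (≢true⇒false (λ v∈p → meet-zero v v∈p e))
  closed (suc u) zero    _ e = ≢true⇒false (λ u∈p → meet-zero u u∈p (trans (color-sym f zero (suc u)) e))
  closed (suc u) (suc v) _ e with p u in pu | p v in pv
  ... | true  | true  = refl
  ... | false | false = refl
  ... | true  | false = contradiction e (leave-p u v pu pv)
  ... | false | true  = contradiction (trans (color-sym f (suc v) (suc u)) e) (leave-p v u pv pu)

does-true : ∀ {A : Set} (a? : Dec A) → does a? ≡ true → A
does-true (yes a) _ = a

does-false : ∀ {A : Set} (a? : Dec A) → does a? ≡ false → ¬ A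
does-false (no ¬a) _ = ¬a

-- Add the vertex 0 to a colouring whose colour c is disconnected, and suppose that 0 sends
-- colour c into every c-component.  If 0 sends some other colour a to y, then the absence of
-- rainbow triangles makes all the edges that leave the component of y have colour a or c.
disconnected-colour : 2 ≤ n → (f : Coloring 3 n) → IsGallai f → ∃ (Disconnected f)
disconnected-colour {suc zero} (s≤s ()) f gallai
disconnected-colour {suc (suc zero)} _ f gallai with third (color f 0F 1F) (color f 0F 1F)
... | c , c≢01 , _ = c , disconnected-at f c (λ _ → true) zero refl (λ _ _ _ ())
                         (λ { zero _ e → c≢01 (sym e) })
disconnected-colour {suc (suc (suc n))} _ f gallai with disconnected-colour (s≤s (s≤s z≤n)) (restrict suc f)
                                            (restrict-gallai suc suc-injective f gallai)
... | c , x₁ , x₂ , l₁≢l₂ = extend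
  where
  f′ = restrict suc f
  gallai′ = restrict-gallai suc suc-injective f gallai
  C = components f′ c
  open Components C

  Touched : Fin (suc (suc n)) → Set
  Touched x = ∃[ y ] label y ≡ label x × color f zero (suc y) ≡ c

  touched? : ∀ x → Dec (Touched x)
  touched? x = any? λ y → label y ≟ label x ×-dec color f zero (suc y) ≟ c

  component : Fin (suc (suc n)) → Fin (suc (suc n)) → Bool
  component x u = does (label u ≟ label x)

  another-component : ∀ y → ∃[ x ] label x ≢ label y
  another-component y with label x₁ ≟ label y
  ... | yes l₁≡ly = x₂ , λ l₂≡ly → l₁≢l₂ (trans l₁≡ly (sym l₂≡ly))
  ... | no  l₁≢ly = x₁ , l₁≢ly

  module _ (touched : ∀ x → Touched x) (y : Fin (suc (suc n))) (0y≢c : color f zero (suc y) ≢ c) where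

    a : Fin 3
    a = color f zero (suc y)

    leaving-y : ∀ {u v} → label u ≡ label y → label v ≢ label y → color f (suc u) (suc v) ≡ a
    leaving-y {u} {v} lu≡ly lv≢ly with touched v
    ... | w , lw≡lv , 0w≡c
      with gallai-triangle f gallai {zero} {suc y} {suc w} 0≢1+n 0≢1+n
             (λ e → lw≢ly (sym (cong label (suc-injective e)))) (λ e → 0y≢c (trans e 0w≡c))
      where
      lw≢ly : label w ≢ label y
      lw≢ly = lv≢ly ∘ trans (sym lw≡lv)
    ... | inj₁ e = trans (between-components f′ gallai′ C lu≡ly (sym lw≡lv)
                            (λ e′ → lv≢ly (trans (sym lw≡lv) (sym e′)))) e
    ... | inj₂ e = contradiction (trans (edge y w (trans e 0w≡c)) lw≡lv) (lv≢ly ∘ sym)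

    from-zero : ∀ {u} → label u ≡ label y → color f zero (suc u) ≡ c ⊎ color f zero (suc u) ≡ a
    from-zero {u} lu≡ly with another-component y
    ... | v , lv≢ly with touched v
    ... | w , lw≡lv , 0w≡c with color f zero (suc u) ≟ c
    ... | yes e = inj₁ e
    ... | no  0u≢c
      with gallai-triangle f gallai {zero} {suc u} {suc w} 0≢1+n 0≢1+n
             (λ e → lw≢lu (sym (cong label (suc-injective e)))) (λ e → 0u≢c (trans e 0w≡c))
      where
      lw≢lu : label w ≢ label u
      lw≢lu e = lv≢ly (trans (sym lw≡lv) (trans e lu≡ly))
    ... | inj₁ e = inj₂ (trans (sym e) (leaving-y lu≡ly (lv≢ly ∘ trans (sym lw≡lv))))
    ... | inj₂ e = contradiction (edge u w (trans e 0w≡c))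
                     (λ e′ → lv≢ly (trans (sym lw≡lv) (trans (sym e′) lu≡ly)))

  extend : ∃ (Disconnected f)
  -- Three cases: a `c`-component that 0 does not touch remains separate; if 0 sends only colour
  -- `c`, it is isolated in any other colour; otherwise the third colour never leaves the component
  -- of `y`, and 0 does not send it there.
  extend with any? (λ x → ¬? (touched? x))
  ... | yes (x , untouched) = c , disconnected-at f c (component x) x (dec-true (label x ≟ label x) refl)
    (λ u v u∈ v∉ e → does-false (label v ≟ label x) v∉
                       (trans (sym (edge u v e)) (does-true (label u ≟ label x) u∈)))
    (λ u u∈ e → untouched (u , does-true (label u ≟ label x) u∈ , e))
  ... | no all-touched with any? (λ y → ¬? (color f zero (suc y) ≟ c))
  ...   | no all-c with third c c
  ...     | b , b≢c , _ = b , disconnected-at f b (λ _ → true) zero refl (λ _ _ _ ())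
    (λ u _ e → b≢c (trans (sym e) (decidable-stable (color f zero (suc u) ≟ c) (λ ≢c → all-c (u , ≢c)))))
  extend | no all-touched | yes (y , 0y≢c) with third c (color f zero (suc y))
  ... | b , b≢c , b≢a = b , disconnected-at f b (component y) y (dec-true (label y ≟ label y) refl)
    (λ u v u∈ v∉ e → b≢a (trans (sym e) (leaving-y touched y 0y≢c
        (does-true (label u ≟ label y) u∈) (does-false (label v ≟ label y) v∉))))
    (λ u u∈ e → [ (λ 0u≡c → b≢c (trans (sym e) 0u≡c)) , (λ 0u≡a → b≢a (trans (sym e) 0u≡a)) ]′
                  (from-zero touched y 0y≢c (does-true (label u ≟ label y) u∈)))
    where
    touched : ∀ x → Touched x
    touched x = decidable-stable (touched? x) (λ ¬t → all-touched (x , ¬t))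

-- Neighbourhoods in one colour and their unions

infixr 6 _∪_
_∪_ : (Fin n → Bool) → (Fin n → Bool) → Fin n → Bool
(p ∪ q) z = p z ∨ q z

-- The diagonal values of a Coloring are junk, so x itself is cut away.
N : Coloring t n → Fin t → Fin n → Fin n → Bool
N f c x z = not (does (x ≟ z)) ∧ does (color f x z ≟ c)

N-elim : (f : Coloring t n) {c : Fin t} → ∀ x z → N f c x z ≡ true → x ≢ z × color f x z ≡ c
N-elim f {c} x z e with x ≟ z | color f x z ≟ c
... | no x≢z | yes xz≡c = x≢z , xz≡c

N-intro : (f : Coloring t n) {c : Fin t} → ∀ {x z} → x ≢ z → color f x z ≡ c → N f c x z ≡ true
N-intro f {c} {x} {z} x≢z xz≡c
  rewrite dec-false (x ≟ z) x≢z | dec-true (color f x z ≟ c) xz≡c = refl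

two-colours : (f : Coloring t n) {c d : Fin t} → c ≢ d → ∀ x z →
              ⟦ N f c x z ⟧ + (⟦ N f d x z ⟧ + ⟦ is x z ⟧) ≤ 1
two-colours f {c} {d} c≢d x z with x ≟ z | color f x z ≟ c | color f x z ≟ d
... | yes _ | _     | _     = ≤-refl
... | no _  | yes e | yes e′ = contradiction (trans (sym e) e′) c≢d
... | no _  | yes _ | no _  = ≤-refl
... | no _  | no _  | yes _ = ≤-refl
... | no _  | no _  | no _  = z≤n

#-∪ : (p q : Fin n → Bool) → # (p ∪ q) ≤ # p + # q
#-∪ p q = subst₂ _≤_ (+-identityʳ _) (cong (# p +_) (+-identityʳ _))
  (total-mono ((p ∪ q) ∷ []) (p ∷ q ∷ [])
    (λ z → subst₂ _≤_ (sym (+-identityʳ _)) (cong (⟦ p z ⟧ +_) (sym (+-identityʳ _))) (⟦∨⟧ (p z) (q z))))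

Monochromatic-cut : Coloring t n → (Fin n → Bool) → Fin t → Set
Monochromatic-cut f p s = ∀ u v → p u ≡ true → p v ≡ false → color f u v ≡ s

-- Arithmetic of component sizes and degrees

module _ (S T : ℕ) where
  open +-*-Solver

  -- The p's are the sizes of four components, and the d's and e's are the degrees of the two ends
  -- of a `t`-edge inside each. In the sum of the last four inequalities every size occurs three
  -- times: twice for the component itself and once as the one component that another sees in some
  -- colour.
  path-sum : ∀ {n} p₁ p₂ p₃ p₄ d₁ d₂ d₃ d₄ e₁ e₂ e₃ e₄ →
             p₁ + (p₂ + (p₃ + (p₄ + 0))) ≤ n →
             T ≤ d₁ + d₂ → T ≤ d₃ + d₄ → T ≤ e₁ + e₂ → T ≤ e₃ + e₄ →
             S + (d₁ + (e₁ + 2)) ≤ p₂ + (p₁ + (p₁ + 0)) →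
             S + (d₂ + (e₂ + 2)) ≤ p₄ + (p₂ + (p₂ + 0)) →
             S + (d₃ + (e₃ + 2)) ≤ p₁ + (p₃ + (p₃ + 0)) →
             S + (d₄ + (e₄ + 2)) ≤ p₃ + (p₄ + (p₄ + 0)) →
             8 + 4 * S + 4 * T ≤ 3 * n
  path-sum {n} p₁ p₂ p₃ p₄ d₁ d₂ d₃ d₄ e₁ e₂ e₃ e₄ sizes d₁₂ d₃₄ e₁₂ e₃₄ i₁ i₂ i₃ i₄ = begin
    8 + 4 * S + 4 * T
      ≡⟨ solve 2 (λ S T → con 8 :+ con 4 :* S :+ con 4 :* T
                          := (con 8 :+ con 4 :* S) :+ ((T :+ T) :+ (T :+ T))) refl S T ⟩
    (8 + 4 * S) + ((T + T) + (T + T))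
      ≤⟨ +-monoʳ-≤ (8 + 4 * S) (+-mono-≤ (+-mono-≤ d₁₂ d₃₄) (+-mono-≤ e₁₂ e₃₄)) ⟩
    (8 + 4 * S) + (((d₁ + d₂) + (d₃ + d₄)) + ((e₁ + e₂) + (e₃ + e₄)))
      ≡⟨ solve 9 (λ S d₁ d₂ d₃ d₄ e₁ e₂ e₃ e₄ →
           (con 8 :+ con 4 :* S) :+ (((d₁ :+ d₂) :+ (d₃ :+ d₄)) :+ ((e₁ :+ e₂) :+ (e₃ :+ e₄)))
           := ((S :+ (d₁ :+ (e₁ :+ con 2))) :+ (S :+ (d₂ :+ (e₂ :+ con 2))))
              :+ ((S :+ (d₃ :+ (e₃ :+ con 2))) :+ (S :+ (d₄ :+ (e₄ :+ con 2)))))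
           refl S d₁ d₂ d₃ d₄ e₁ e₂ e₃ e₄ ⟩
    ((S + (d₁ + (e₁ + 2))) + (S + (d₂ + (e₂ + 2)))) + ((S + (d₃ + (e₃ + 2))) + (S + (d₄ + (e₄ + 2))))
      ≤⟨ +-mono-≤ (+-mono-≤ i₁ i₂) (+-mono-≤ i₃ i₄) ⟩
    ((p₂ + (p₁ + (p₁ + 0))) + (p₄ + (p₂ + (p₂ + 0)))) + ((p₁ + (p₃ + (p₃ + 0))) + (p₃ + (p₄ + (p₄ + 0))))
      ≡⟨ solve 4 (λ p₁ p₂ p₃ p₄ →
           ((p₂ :+ (p₁ :+ (p₁ :+ con 0))) :+ (p₄ :+ (p₂ :+ (p₂ :+ con 0))))
           :+ ((p₁ :+ (p₃ :+ (p₃ :+ con 0))) :+ (p₃ :+ (p₄ :+ (p₄ :+ con 0))))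
           := con 3 :* (p₁ :+ (p₂ :+ (p₃ :+ (p₄ :+ con 0))))) refl p₁ p₂ p₃ p₄ ⟩
    3 * (p₁ + (p₂ + (p₃ + (p₄ + 0))))
      ≤⟨ *-monoʳ-≤ 3 sizes ⟩
    3 * n ∎
    where open ≤-Reasoning

  -- The degree bounds are added around a 5-cycle of components, so each degree is counted twice,
  -- and each degree is smaller than the size of its component.
  five-sum : ∀ {n} p₁ p₂ p₃ p₄ p₅ d₁ d₂ d₃ d₄ d₅ →
             p₁ + (p₂ + (p₃ + (p₄ + (p₅ + 0)))) ≤ n →
             suc d₁ ≤ p₁ → suc d₂ ≤ p₂ → suc d₃ ≤ p₃ → suc d₄ ≤ p₄ → suc d₅ ≤ p₅ →
             T ≤ d₁ + d₂ → T ≤ d₂ + d₃ → T ≤ d₃ + d₄ → T ≤ d₄ + d₅ → T ≤ d₁ + d₅ →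
             10 + 5 * T ≤ 2 * n
  five-sum {n} p₁ p₂ p₃ p₄ p₅ d₁ d₂ d₃ d₄ d₅ sizes s₁ s₂ s₃ s₄ s₅ t₁ t₂ t₃ t₄ t₅ = begin
    10 + 5 * T
      ≡⟨ solve 1 (λ T → con 10 :+ con 5 :* T := con 10 :+ (T :+ (T :+ (T :+ (T :+ T))))) refl T ⟩
    10 + (T + (T + (T + (T + T))))
      ≤⟨ +-monoʳ-≤ 10 (+-mono-≤ t₁ (+-mono-≤ t₂ (+-mono-≤ t₃ (+-mono-≤ t₄ t₅)))) ⟩
    10 + ((d₁ + d₂) + ((d₂ + d₃) + ((d₃ + d₄) + ((d₄ + d₅) + (d₁ + d₅)))))
      ≡⟨ solve 5 (λ d₁ d₂ d₃ d₄ d₅ →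
           con 10 :+ ((d₁ :+ d₂) :+ ((d₂ :+ d₃) :+ ((d₃ :+ d₄) :+ ((d₄ :+ d₅) :+ (d₁ :+ d₅)))))
           := con 2 :* ((con 1 :+ d₁) :+ ((con 1 :+ d₂) :+ ((con 1 :+ d₃) :+
                ((con 1 :+ d₄) :+ ((con 1 :+ d₅) :+ con 0)))))) refl d₁ d₂ d₃ d₄ d₅ ⟩
    2 * (suc d₁ + (suc d₂ + (suc d₃ + (suc d₄ + (suc d₅ + 0)))))
      ≤⟨ *-monoʳ-≤ 2 (+-mono-≤ s₁ (+-mono-≤ s₂ (+-mono-≤ s₃ (+-mono-≤ s₄ (+-monoˡ-≤ 0 s₅))))) ⟩
    2 * (p₁ + (p₂ + (p₃ + (p₄ + (p₅ + 0)))))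
      ≤⟨ *-monoʳ-≤ 2 sizes ⟩
    2 * n ∎
    where open ≤-Reasoning

  isolated-sum : ∀ {n} p₁ p₂ p₃ p₄ → p₁ + (p₂ + (p₃ + (p₄ + 0))) ≤ n →
                 1 ≤ p₁ → suc T ≤ p₂ → suc T ≤ p₃ → suc T ≤ p₄ → 4 + 3 * T ≤ n
  isolated-sum {n} p₁ p₂ p₃ p₄ sizes s₁ s₂ s₃ s₄ = begin
    4 + 3 * T
      ≡⟨ solve 1 (λ T → con 4 :+ con 3 :* T := con 1 :+ ((con 1 :+ T) :+ ((con 1 :+ T) :+
                          ((con 1 :+ T) :+ con 0)))) refl T ⟩
    1 + (suc T + (suc T + (suc T + 0)))
      ≤⟨ +-mono-≤ s₁ (+-mono-≤ s₂ (+-mono-≤ s₃ (+-monoˡ-≤ 0 s₄))) ⟩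
    p₁ + (p₂ + (p₃ + (p₄ + 0)))
      ≤⟨ sizes ⟩
    n ∎
    where open ≤-Reasoning

-- The reduced colouring of the components

module Partition
  (f : Coloring 3 n) (gallai : IsGallai f) (t : Fin 3) (S T : ℕ)
  -- `T` bounds unions of neighbourhoods in colour `t`, and `S` those in the other colours. They are
  -- kept apart because deleting an apex lowers the bound only for the apex colour.
  (t-union : ∀ {x y} → x ≢ y → color f x y ≢ t → T ≤ # (N f t x ∪ N f t y))
  (s-union : ∀ {x y s} → x ≢ y → color f x y ≡ t → s ≢ t → S ≤ # (N f s x ∪ N f s y))
  (no-cut : ∀ p s {x y} → p x ≡ true → p y ≡ false → ¬ Monochromatic-cut f p s)
  (path-bound : 3 * n < 8 + 4 * S + 4 * T)
  (five-bound : 2 * n < 10 + 5 * T)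
  (isolated-bound : n < 4 + 3 * T)
  where

  C : Components f t
  C = components f t

  open Components C

  part : Fin n → Fin n → Bool
  part x z = does (label z ≟ label x)

  deg : Fin n → ℕ
  deg x = # (N f t x)

  _≁_ : Fin n → Fin n → Set
  x ≁ y = label x ≢ label y

  ≁-colour : ∀ {x y} → x ≁ y → color f x y ≢ t
  ≁-colour {x} {y} x≁y e = x≁y (edge x y e)

  deg-sum : ∀ {x y} → x ≁ y → T ≤ deg x + deg y
  deg-sum {x} {y} x≁y = ≤-trans (t-union (x≁y ∘ cong label) (≁-colour x≁y)) (#-∪ (N f t x) (N f t y))

  deg<size : ∀ x → suc (deg x) ≤ # (part x)
  deg<size x = begin
    suc (deg x)                   ≡⟨ cong₂ _+_ (sym (#-is x)) (sym (+-identityʳ (deg x))) ⟩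
    total (is x ∷ N f t x ∷ [])   ≤⟨ total-mono (is x ∷ N f t x ∷ []) (part x ∷ []) pointwise ⟩
    # (part x) + 0                ≡⟨ +-identityʳ _ ⟩
    # (part x)                    ∎
    where
    open ≤-Reasoning
    pointwise : ∀ z → weight (is x ∷ N f t x ∷ []) z ≤ weight (part x ∷ []) z
    pointwise z with x ≟ z
    ... | yes refl rewrite dec-true (label x ≟ label x) refl = ≤-refl
    ... | no x≢z with color f x z ≟ t
    ...   | no _ = z≤n
    ...   | yes e rewrite dec-true (label z ≟ label x) (sym (edge x z e)) = ≤-refl

  part-sizes : ∀ xs → AllPairs _≁_ xs → total (map part xs) ≤ n
  part-sizes xs xs≁ = ≤-trans (total-mono (map part xs) (all-members ∷ []) (disjoint xs xs≁))
    (≤-reflexive (trans (+-identityʳ _) (#-all n)))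
    where
    avoid : ∀ {z} xs → All (λ x → label z ≢ label x) xs → weight (map part xs) z ≡ 0
    avoid [] [] = refl
    avoid {z} (x ∷ xs) (z≁x ∷ z≁xs) rewrite dec-false (label z ≟ label x) z≁x = avoid xs z≁xs

    disjoint : ∀ xs → AllPairs _≁_ xs → ∀ z → weight (map part xs) z ≤ 1
    disjoint [] [] z = z≤n
    disjoint (x ∷ xs) (x≁xs ∷ xs≁) z with label z ≟ label x
    ... | no _ = disjoint xs xs≁ z
    ... | yes lz≡lx = ≤-reflexive (cong suc (avoid xs (All.map (λ x≁y → x≁y ∘ trans (sym lz≡lx)) x≁xs)))

  at-most-four : ∀ {x₁ x₂ x₃ x₄ x₅} → ¬ AllPairs _≁_ (x₁ ∷ x₂ ∷ x₃ ∷ x₄ ∷ x₅ ∷ [])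
  at-most-four {x₁} {x₂} {x₃} {x₄} {x₅}
    xs≁@((p₁₂ ∷ _ ∷ _ ∷ p₁₅ ∷ []) ∷ (p₂₃ ∷ _ ∷ _ ∷ []) ∷ (p₃₄ ∷ _ ∷ []) ∷ (p₄₅ ∷ []) ∷ [] ∷ []) =
    <⇒≱ five-bound (five-sum S T (# (part x₁)) (# (part x₂)) (# (part x₃)) (# (part x₄)) (# (part x₅))
      (deg x₁) (deg x₂) (deg x₃) (deg x₄) (deg x₅)
      (part-sizes _ xs≁)
      (deg<size x₁) (deg<size x₂) (deg<size x₃) (deg<size x₄) (deg<size x₅)
      (deg-sum p₁₂) (deg-sum p₂₃) (deg-sum p₃₄) (deg-sum p₄₅) (deg-sum p₁₅))

  -- If `x` had degree 0 in colour `t`, then `deg-sum` would give every vertex outside its component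
  -- degree at least `T`. The three other components would then have more than `T` vertices each,
  -- against `isolated-bound`.
  neighbour : ∀ {x x₂ x₃ x₄} → AllPairs _≁_ (x ∷ x₂ ∷ x₃ ∷ x₄ ∷ []) →
              ∃[ y ] x ≢ y × color f x y ≡ t
  neighbour {x} {x₂} {x₃} {x₄} xs≁@((p₂ ∷ p₃ ∷ p₄ ∷ []) ∷ _)
    with any? (λ y → ¬? (x ≟ y) ×-dec color f x y ≟ t)
  ... | yes found = found
  ... | no none = contradiction (isolated-sum S T (# (part x)) (# (part x₂)) (# (part x₃)) (# (part x₄)) (part-sizes _ xs≁)
                    (≤-trans (s≤s z≤n) (deg<size x)) (big p₂) (big p₃) (big p₄)) (<⇒≱ isolated-bound)
    where
    deg≡0 : deg x ≡ 0
    deg≡0 = #-none (N f t x) (λ z → ≢true⇒false (λ z∈N → none (z , N-elim f x z z∈N)))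
    big : ∀ {y} → x ≁ y → suc T ≤ # (part y)
    big {y} x≁y = ≤-trans (s≤s (subst (λ d → T ≤ d + deg y) deg≡0 (deg-sum x≁y))) (deg<size y)

  -- A vertex in the component of `x` is counted at most twice on the left, once on account of `x`
  -- and once on account of `x′`. A vertex outside it can only be counted in the union of the
  -- `s`-neighbourhoods, and then it lies in the component of `y`. The summand 2 counts `x` and `x′`
  -- themselves.
  part-inequality : ∀ {x x′ y s} → s ≢ t → x ≢ x′ → color f x x′ ≡ t →
                    (∀ z → x ≁ z → color f x z ≡ s → label z ≡ label y) →
                    S + (deg x + (deg x′ + 2)) ≤ # (part y) + (# (part x) + (# (part x) + 0))
  part-inequality {x} {x′} {y} {s} s≢t x≢x′ xx′≡t only-y = begin
    S + (deg x + (deg x′ + 2))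
      ≤⟨ +-monoˡ-≤ _ (s-union x≢x′ xx′≡t s≢t) ⟩
    # U + (deg x + (deg x′ + 2))
      ≡⟨ cong (λ k → # U + (deg x + (deg x′ + k)))
              (sym (cong₂ (λ a b → a + (b + 0)) (#-is x) (#-is x′))) ⟩
    total (U ∷ N f t x ∷ N f t x′ ∷ is x ∷ is x′ ∷ [])
      ≤⟨ total-mono (U ∷ N f t x ∷ N f t x′ ∷ is x ∷ is x′ ∷ []) (part y ∷ part x ∷ part x ∷ []) pointwise ⟩
    total (part y ∷ part x ∷ part x ∷ []) ∎
    where
    open ≤-Reasoning
    U : Fin n → Bool
    U = N f s x ∪ N f s x′

    lx≡lx′ : label x ≡ label x′
    lx≡lx′ = edge x x′ xx′≡t

    outside : ∀ {w} z → label x ≡ label w → label z ≢ label x → ⟦ N f t w z ⟧ ≡ 0 × ⟦ is w z ⟧ ≡ 0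
    outside {w} z lx≡lw z≁x =
      cong ⟦_⟧ (≢true⇒false (λ e → z≁x (sym (trans lx≡lw (edge w z (proj₂ (N-elim f w z e))))))) ,
      cong ⟦_⟧ (dec-false (w ≟ z) (λ { refl → z≁x (sym lx≡lw) }))

    U⇒y : ∀ z → label z ≢ label x → U z ≡ true → label z ≡ label y
    U⇒y z z≁x z∈U with ∨-true (N f s x z) z∈U
    ... | inj₁ e = only-y z (z≁x ∘ sym) (proj₂ (N-elim f x z e))
    ... | inj₂ e = only-y z (z≁x ∘ sym)
                     (trans (outside-colour f gallai C x x′ z lx≡lx′ (z≁x ∘ sym)) (proj₂ (N-elim f x′ z e)))

    rearrange : ∀ a b c d e g → (a + b) + (c + (d + (e + (g + 0)))) ≡ (a + (c + e)) + (b + (d + g))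
    rearrange = solve 6 (λ a b c d e g → (a :+ b) :+ (c :+ (d :+ (e :+ (g :+ con 0))))
                                         := (a :+ (c :+ e)) :+ (b :+ (d :+ g))) refl
      where open +-*-Solver

    pointwise : ∀ z → weight (U ∷ N f t x ∷ N f t x′ ∷ is x ∷ is x′ ∷ []) z
                      ≤ weight (part y ∷ part x ∷ part x ∷ []) z
    pointwise z with label z ≟ label x
    ... | yes _ = begin
      ⟦ U z ⟧ + (⟦ N f t x z ⟧ + (⟦ N f t x′ z ⟧ + (⟦ is x z ⟧ + (⟦ is x′ z ⟧ + 0))))
        ≤⟨ +-monoˡ-≤ _ (⟦∨⟧ (N f s x z) (N f s x′ z)) ⟩
      (⟦ N f s x z ⟧ + ⟦ N f s x′ z ⟧) + (⟦ N f t x z ⟧ + (⟦ N f t x′ z ⟧ + (⟦ is x z ⟧ + (⟦ is x′ z ⟧ + 0))))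
        ≡⟨ rearrange ⟦ N f s x z ⟧ ⟦ N f s x′ z ⟧ ⟦ N f t x z ⟧ ⟦ N f t x′ z ⟧ ⟦ is x z ⟧ ⟦ is x′ z ⟧ ⟩
      (⟦ N f s x z ⟧ + (⟦ N f t x z ⟧ + ⟦ is x z ⟧)) + (⟦ N f s x′ z ⟧ + (⟦ N f t x′ z ⟧ + ⟦ is x′ z ⟧))
        ≤⟨ +-mono-≤ (two-colours f s≢t x z) (two-colours f s≢t x′ z) ⟩
      2
        ≤⟨ m≤n+m 2 ⟦ part y z ⟧ ⟩
      ⟦ part y z ⟧ + 2 ∎
    ... | no z≁x
      rewrite proj₁ (outside z refl z≁x) | proj₂ (outside z refl z≁x)
            | proj₁ (outside z lx≡lx′ z≁x) | proj₂ (outside z lx≡lx′ z≁x) =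
      +-monoˡ-≤ 0 (⟦⟧-mono {U z} (λ z∈U → dec-true (label z ≟ label y) (U⇒y z z≁x z∈U)))

  Covers : List (Fin n) → Set
  Covers xs = ∀ z → Any (λ x → label z ≡ label x) xs

  new-part : ∀ xs → (∃[ z ] All (λ x → z ≁ x) xs) ⊎ Covers xs
  new-part xs with any? (λ z → ¬? (Any.any? (λ x → label z ≟ label x) xs))
  ... | yes (z , z∉) = inj₁ (z , ¬Any⇒All¬ xs z∉)
  ... | no none = inj₂ (λ z → decidable-stable (Any.any? (λ x → label z ≟ label x) xs)
                                               (λ z∉ → none (z , z∉)))

  -- Such a component would be one side of a monochromatic cut, with `y` on the other side.
  no-star : ∀ {x y s} → x ≁ y → ¬ (∀ z → x ≁ z → color f x z ≡ s)
  no-star {x} {y} {s} x≁y star = no-cut (part x) s {x} {y}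
    (dec-true (label x ≟ label x) refl) (dec-false (label y ≟ label x) (x≁y ∘ sym))
    (λ u v u∈ v∉ → let lu≡lx = does-true (label u ≟ label x) u∈
                       v≁x   = does-false (label v ≟ label x) v∉
                   in trans (between-components f gallai C lu≡lx refl (v≁x ∘ sym)) (star v (v≁x ∘ sym)))

  no-double-star : ∀ {x x′ y s} → x ≁ y → x′ ≁ y →
                   ¬ (∀ z → x ≁ z → x′ ≁ z → color f x z ≡ s × color f x′ z ≡ s)
  no-double-star {x} {x′} {y} {s} x≁y x′≁y star = no-cut (part x ∪ part x′) s {x} {y} x∈ y∉ cut
    where
    x∈ : (part x ∪ part x′) x ≡ true
    x∈ rewrite dec-true (label x ≟ label x) refl = refl
    y∉ : (part x ∪ part x′) y ≡ false
    y∉ rewrite dec-false (label y ≟ label x) (x≁y ∘ sym) = dec-false (label y ≟ label x′) (x′≁y ∘ sym)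
    cut : Monochromatic-cut f (part x ∪ part x′) s
    cut u v u∈ v∉ with label v ≟ label x | label v ≟ label x′ | ∨-true (part x u) u∈
    ... | no v≁x | no v≁x′ | inj₁ u∈x =
      trans (between-components f gallai C (does-true (label u ≟ label x) u∈x) refl (v≁x ∘ sym))
            (proj₁ (star v (v≁x ∘ sym) (v≁x′ ∘ sym)))
    ... | no v≁x | no v≁x′ | inj₂ u∈x′ =
      trans (between-components f gallai C (does-true (label u ≟ label x′) u∈x′) refl (v≁x′ ∘ sym))
            (proj₂ (star v (v≁x ∘ sym) (v≁x′ ∘ sym)))
    cut u v u∈ () | yes _ | _     | _
    cut u v u∈ () | no _  | yes _ | _

  to-part : ∀ {x y z s} → x ≁ z → color f x y ≡ s → label z ≡ label y → color f x z ≡ s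
  to-part {x} x≁z xy≡s lz≡ly =
    trans (between-components f gallai C {v = _} {y = _} refl lz≡ly (λ e → x≁z (trans e (sym lz≡ly)))) xy≡s

  flip : ∀ {x y s} → color f x y ≡ s → color f y x ≡ s
  flip {x} {y} = trans (color-sym f y x)

  -- The reduced colouring is the path x₁x₂x₃x₄ in one colour; every part sees exactly one
  -- other part in one of the two colours, and these parts form the cycle x₁, x₂, x₄, x₃.
  no-path : ∀ {x₁ x₂ x₃ x₄ a b} → AllPairs _≁_ (x₁ ∷ x₂ ∷ x₃ ∷ x₄ ∷ []) → Covers (x₁ ∷ x₂ ∷ x₃ ∷ x₄ ∷ []) →
            a ≢ b → color f x₁ x₂ ≡ a → color f x₂ x₃ ≡ a → color f x₃ x₄ ≡ a →
            color f x₁ x₃ ≡ b → color f x₁ x₄ ≡ b → color f x₂ x₄ ≡ b → ⊥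
  no-path {x₁} {x₂} {x₃} {x₄} {a} {b}
    xs≁@((p₁₂ ∷ p₁₃ ∷ p₁₄ ∷ []) ∷ (p₂₃ ∷ p₂₄ ∷ []) ∷ (p₃₄ ∷ []) ∷ [] ∷ [])
    cover a≢b c₁₂ c₂₃ c₃₄ c₁₃ c₁₄ c₂₄
    with neighbour xs≁
       | neighbour ((≢-sym p₁₂ ∷ p₂₃ ∷ p₂₄ ∷ []) ∷ (p₁₃ ∷ p₁₄ ∷ []) ∷ (p₃₄ ∷ []) ∷ [] ∷ [])
       | neighbour ((≢-sym p₁₃ ∷ ≢-sym p₂₃ ∷ p₃₄ ∷ []) ∷ (p₁₂ ∷ p₁₄ ∷ []) ∷ (p₂₄ ∷ []) ∷ [] ∷ [])
       | neighbour ((≢-sym p₁₄ ∷ ≢-sym p₂₄ ∷ ≢-sym p₃₄ ∷ []) ∷ (p₁₂ ∷ p₁₃ ∷ []) ∷ (p₂₃ ∷ []) ∷ [] ∷ [])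
  ... | y₁ , x₁≢y₁ , e₁ | y₂ , x₂≢y₂ , e₂ | y₃ , x₃≢y₃ , e₃ | y₄ , x₄≢y₄ , e₄ =
    <⇒≱ path-bound (path-sum S T (# (part x₁)) (# (part x₂)) (# (part x₃)) (# (part x₄))
      (deg x₁) (deg x₂) (deg x₃) (deg x₄) (deg y₁) (deg y₂) (deg y₃) (deg y₄)
      (part-sizes _ xs≁) (deg-sum p₁₂) (deg-sum p₃₄)
      (deg-sum (λ e → p₁₂ (trans (edge _ _ e₁) (trans e (sym (edge _ _ e₂))))))
      (deg-sum (λ e → p₃₄ (trans (edge _ _ e₃) (trans e (sym (edge _ _ e₄))))))
      (part-inequality a≢t x₁≢y₁ e₁ only₁) (part-inequality b≢t x₂≢y₂ e₂ only₂)
      (part-inequality b≢t x₃≢y₃ e₃ only₃) (part-inequality a≢t x₄≢y₄ e₄ only₄))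
    where
    a≢t : a ≢ t
    a≢t = ≁-colour p₁₂ ∘ trans c₁₂
    b≢t : b ≢ t
    b≢t = ≁-colour p₁₃ ∘ trans c₁₃

    wrong : ∀ {A : Set} {x y z c d} → c ≢ d → x ≁ z → color f x y ≡ c → color f x z ≡ d →
            label z ≡ label y → A
    wrong c≢d x≁z xy≡c xz≡d lz≡ly = contradiction (trans (sym (to-part x≁z xy≡c lz≡ly)) xz≡d) c≢d

    only₁ : ∀ z → x₁ ≁ z → color f x₁ z ≡ a → label z ≡ label x₂
    only₁ z x≁z e with cover z
    ... | here lz≡                         = contradiction (sym lz≡) x≁z
    ... | there (here lz≡)                 = lz≡
    ... | there (there (here lz≡))         = wrong (≢-sym a≢b) x≁z c₁₃ e lz≡
    ... | there (there (there (here lz≡))) = wrong (≢-sym a≢b) x≁z c₁₄ e lz≡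

    only₂ : ∀ z → x₂ ≁ z → color f x₂ z ≡ b → label z ≡ label x₄
    only₂ z x≁z e with cover z
    ... | here lz≡                         = wrong a≢b x≁z (flip c₁₂) e lz≡
    ... | there (here lz≡)                 = contradiction (sym lz≡) x≁z
    ... | there (there (here lz≡))         = wrong a≢b x≁z c₂₃ e lz≡
    ... | there (there (there (here lz≡))) = lz≡

    only₃ : ∀ z → x₃ ≁ z → color f x₃ z ≡ b → label z ≡ label x₁
    only₃ z x≁z e with cover z
    ... | here lz≡                         = lz≡
    ... | there (here lz≡)                 = wrong a≢b x≁z (flip c₂₃) e lz≡
    ... | there (there (here lz≡))         = contradiction (sym lz≡) x≁z
    ... | there (there (there (here lz≡))) = wrong a≢b x≁z c₃₄ e lz≡

    only₄ : ∀ z → x₄ ≁ z → color f x₄ z ≡ a → label z ≡ label x₃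
    only₄ z x≁z e with cover z
    ... | here lz≡                         = wrong (≢-sym a≢b) x≁z (flip c₁₄) e lz≡
    ... | there (here lz≡)                 = wrong (≢-sym a≢b) x≁z (flip c₂₄) e lz≡
    ... | there (there (here lz≡))         = lz≡
    ... | there (there (there (here lz≡))) = contradiction (sym lz≡) x≁z

  -- Edges between components never have colour `t`, so only two colours remain for them.
  two-valued : ∀ {x y z u v} → x ≁ y → x ≁ z → u ≁ v → color f x y ≢ color f x z →
               color f u v ≡ color f x y ⊎ color f u v ≡ color f x z
  two-valued x≁y x≁z u≁v xy≢xz =
    one-of-two t _ _ _ xy≢xz (≁-colour x≁y) (≁-colour x≁z) (≁-colour u≁v)

  star₂ : ∀ {x₁ x₂} → x₁ ≁ x₂ → ¬ Covers (x₁ ∷ x₂ ∷ [])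
  star₂ {x₁} {x₂} x₁≁x₂ cover = no-star x₁≁x₂ λ z x≁z → case cover z of λ
    { (here lz≡)         → contradiction (sym lz≡) x≁z
    ; (there (here lz≡)) → to-part x≁z refl lz≡ }

  star₃ : ∀ {x y₁ y₂ s} → x ≁ y₁ → Covers (x ∷ y₁ ∷ y₂ ∷ []) →
          color f x y₁ ≡ s → color f x y₂ ≡ s → ⊥
  star₃ x≁y₁ cover e₁ e₂ = no-star x≁y₁ λ z x≁z → case cover z of λ
    { (here lz≡)                 → contradiction (sym lz≡) x≁z
    ; (there (here lz≡))         → to-part x≁z e₁ lz≡
    ; (there (there (here lz≡))) → to-part x≁z e₂ lz≡ }

  star₄ : ∀ {x y₁ y₂ y₃ s} → x ≁ y₁ → Covers (x ∷ y₁ ∷ y₂ ∷ y₃ ∷ []) →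
          color f x y₁ ≡ s → color f x y₂ ≡ s → color f x y₃ ≡ s → ⊥
  star₄ x≁y₁ cover e₁ e₂ e₃ = no-star x≁y₁ λ z x≁z → case cover z of λ
    { (here lz≡)                         → contradiction (sym lz≡) x≁z
    ; (there (here lz≡))                 → to-part x≁z e₁ lz≡
    ; (there (there (here lz≡)))         → to-part x≁z e₂ lz≡
    ; (there (there (there (here lz≡)))) → to-part x≁z e₃ lz≡ }

  double-star₄ : ∀ {x x′ y₁ y₂ s} → x ≁ y₁ → x′ ≁ y₁ → Covers (x ∷ x′ ∷ y₁ ∷ y₂ ∷ []) →
                 color f x y₁ ≡ s → color f x y₂ ≡ s → color f x′ y₁ ≡ s → color f x′ y₂ ≡ s → ⊥
  double-star₄ x≁y₁ x′≁y₁ cover e₁ e₂ e₁′ e₂′ = no-double-star x≁y₁ x′≁y₁ λ z x≁z x′≁z → case cover z of λ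
    { (here lz≡)                         → contradiction (sym lz≡) x≁z
    ; (there (here lz≡))                 → contradiction (sym lz≡) x′≁z
    ; (there (there (here lz≡)))         → to-part x≁z e₁ lz≡ , to-part x′≁z e₁′ lz≡
    ; (there (there (there (here lz≡)))) → to-part x≁z e₂ lz≡ , to-part x′≁z e₂′ lz≡ }

  swap₁₂ : ∀ {x y zs} → AllPairs _≁_ (x ∷ y ∷ zs) → AllPairs _≁_ (y ∷ x ∷ zs)
  swap₁₂ ((x≁y ∷ x≁zs) ∷ (y≁zs ∷ zs≁)) = (≢-sym x≁y ∷ y≁zs) ∷ (x≁zs ∷ zs≁)

  swap₂₃ : ∀ {x y z ws} → AllPairs _≁_ (x ∷ y ∷ z ∷ ws) → AllPairs _≁_ (x ∷ z ∷ y ∷ ws)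
  swap₂₃ ((x≁y ∷ x≁z ∷ x≁ws) ∷ ≁) = (x≁z ∷ x≁y ∷ x≁ws) ∷ swap₁₂ ≁

  swap₃₄ : ∀ {x y z w vs} → AllPairs _≁_ (x ∷ y ∷ z ∷ w ∷ vs) → AllPairs _≁_ (x ∷ y ∷ w ∷ z ∷ vs)
  swap₃₄ ((x≁y ∷ x≁z ∷ x≁w ∷ x≁vs) ∷ ≁) = (x≁y ∷ x≁w ∷ x≁z ∷ x≁vs) ∷ swap₂₃ ≁

  Any-swap₁₂ : ∀ {P : Fin n → Set} {x y zs} → Any P (x ∷ y ∷ zs) → Any P (y ∷ x ∷ zs)
  Any-swap₁₂ (here px)          = there (here px)
  Any-swap₁₂ (there (here py))  = here py
  Any-swap₁₂ (there (there ps)) = there (there ps)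

  Any-there : ∀ {P : Fin n → Set} {x ys zs} → (Any P ys → Any P zs) → Any P (x ∷ ys) → Any P (x ∷ zs)
  Any-there g (here px)  = here px
  Any-there g (there ps) = there (g ps)

  -- Let a be the colour of x₁x₂ and b that of x₁x₃ and x₁x₄. If x₂ sends a to both x₃ and x₄, it is
  -- the centre of a star; if it sends b to both, then x₁, x₂ against x₃, x₄ is a cut. In the mixed
  -- cases the colour of x₃x₄ yields an a-coloured path on four vertices or a b-coloured star.
  no-four : ∀ {x₁ x₂ x₃ x₄} → AllPairs _≁_ (x₁ ∷ x₂ ∷ x₃ ∷ x₄ ∷ []) → Covers (x₁ ∷ x₂ ∷ x₃ ∷ x₄ ∷ []) →
            color f x₁ x₂ ≢ color f x₁ x₃ → color f x₁ x₃ ≡ color f x₁ x₄ → ⊥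
  no-four {x₁} {x₂} {x₃} {x₄} xs≁@((p₁₂ ∷ p₁₃ ∷ p₁₄ ∷ []) ∷ (p₂₃ ∷ p₂₄ ∷ []) ∷ (p₃₄ ∷ []) ∷ [] ∷ [])
    cover a≢b c₁₃≡c₁₄
    with two-valued p₁₂ p₁₃ p₂₃ a≢b | two-valued p₁₂ p₁₃ p₂₄ a≢b | two-valued p₁₂ p₁₃ p₃₄ a≢b
  ... | inj₁ c₂₃ | inj₁ c₂₄ | _ =
    star₄ (≢-sym p₁₂) (Any-swap₁₂ ∘ cover) (flip refl) c₂₃ c₂₄
  ... | inj₂ c₂₃ | inj₂ c₂₄ | _ =
    double-star₄ p₁₃ p₂₃ cover refl (sym c₁₃≡c₁₄) c₂₃ c₂₄
  ... | inj₁ c₂₃ | inj₂ c₂₄ | inj₁ c₃₄ =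
    no-path xs≁ cover a≢b refl c₂₃ c₃₄ refl (sym c₁₃≡c₁₄) c₂₄
  ... | inj₂ c₂₃ | inj₁ c₂₄ | inj₁ c₃₄ =
    no-path (swap₃₄ xs≁) (Any-there (Any-there Any-swap₁₂) ∘ cover)
            a≢b refl c₂₄ (flip c₃₄) (sym c₁₃≡c₁₄) refl c₂₃
  ... | inj₁ c₂₃ | inj₂ c₂₄ | inj₂ c₃₄ =
    star₄ (≢-sym p₁₄) (Any-swap₁₂ ∘ Any-there (Any-swap₁₂ ∘ Any-there Any-swap₁₂) ∘ cover)
          (flip (sym c₁₃≡c₁₄)) (flip c₂₄) (flip c₃₄)
  ... | inj₂ c₂₃ | inj₁ c₂₄ | inj₂ c₃₄ =
    star₄ (≢-sym p₁₃) (Any-swap₁₂ ∘ Any-there Any-swap₁₂ ∘ cover)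
          (flip refl) (flip c₂₃) c₃₄

  -- With two colours on a triangle, some vertex has both its edges in the same colour and is the
  -- centre of a star.
  not-three : ∀ {x₁ x₂ x₃} → AllPairs _≁_ (x₁ ∷ x₂ ∷ x₃ ∷ []) → ¬ Covers (x₁ ∷ x₂ ∷ x₃ ∷ [])
  not-three {x₁} {x₂} {x₃} ((p₁₂ ∷ p₁₃ ∷ []) ∷ (p₂₃ ∷ []) ∷ [] ∷ []) cover
    with color f x₁ x₂ ≟ color f x₁ x₃
  ... | yes e = star₃ p₁₂ cover e refl
  ... | no a≢b with two-valued p₁₂ p₁₃ p₂₃ a≢b
  ...   | inj₁ c₂₃ = star₃ (≢-sym p₁₂) (Any-swap₁₂ ∘ cover) (flip refl) c₂₃
  ...   | inj₂ c₂₃ = star₃ (≢-sym p₁₃) (Any-swap₁₂ ∘ Any-there Any-swap₁₂ ∘ cover) (flip refl) (flip c₂₃)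

  -- Of the three edges at `x₁` either all agree, which is a star, or exactly one differs;
  -- reordering puts the odd one first, as `no-four` expects.
  not-four : ∀ {x₁ x₂ x₃ x₄} → AllPairs _≁_ (x₁ ∷ x₂ ∷ x₃ ∷ x₄ ∷ []) → ¬ Covers (x₁ ∷ x₂ ∷ x₃ ∷ x₄ ∷ [])
  not-four {x₁} {x₂} {x₃} {x₄} xs≁@((p₁₂ ∷ p₁₃ ∷ p₁₄ ∷ []) ∷ _) cover
    with color f x₁ x₂ ≟ color f x₁ x₃ | color f x₁ x₂ ≟ color f x₁ x₄
  ... | yes e₃ | yes e₄ = star₄ p₁₂ cover refl (sym e₃) (sym e₄)
  ... | yes e₃ | no c₁₂≢c₁₄ = no-four (swap₂₃ (swap₃₄ xs≁))
    (Any-there Any-swap₁₂ ∘ Any-there (Any-there Any-swap₁₂) ∘ cover) (≢-sym c₁₂≢c₁₄) e₃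
  ... | no c₁₂≢c₁₃ | yes e₄ = no-four (swap₂₃ xs≁) (Any-there Any-swap₁₂ ∘ cover) (≢-sym c₁₂≢c₁₃) e₄
  ... | no c₁₂≢c₁₃ | no c₁₂≢c₁₄ with two-valued p₁₂ p₁₃ p₁₄ c₁₂≢c₁₃
  ...   | inj₁ e = contradiction (sym e) c₁₂≢c₁₄
  ...   | inj₂ e = no-four xs≁ cover c₁₂≢c₁₃ (sym e)

  -- Representatives of new components are added until all components are met. Two, three and four
  -- are excluded by cuts or by the path, five by counting.
  connected-colour : ¬ Disconnected f t
  connected-colour (x₁ , x₂ , x₁≁x₂) with new-part (x₁ ∷ x₂ ∷ [])
  ... | inj₂ cover = star₂ x₁≁x₂ cover
  ... | inj₁ (x₃ , x₃≁) with new-part (x₃ ∷ x₁ ∷ x₂ ∷ [])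
  ...   | inj₂ cover = not-three (x₃≁ ∷ (x₁≁x₂ ∷ []) ∷ [] ∷ []) cover
  ...   | inj₁ (x₄ , x₄≁) with new-part (x₄ ∷ x₃ ∷ x₁ ∷ x₂ ∷ [])
  ...     | inj₂ cover = not-four (x₄≁ ∷ x₃≁ ∷ (x₁≁x₂ ∷ []) ∷ [] ∷ []) cover
  ...     | inj₁ (x₅ , x₅≁) = at-most-four (x₅≁ ∷ x₄≁ ∷ x₃≁ ∷ (x₁≁x₂ ∷ []) ∷ [] ∷ [])

-- Monochromatic cuts

#-mono : {p q : Fin n → Bool} → (∀ z → p z ≡ true → q z ≡ true) → # p ≤ # q
#-mono {p = p} {q} p⊆q = subst₂ _≤_ (+-identityʳ (# p)) (+-identityʳ (# q))
  (total-mono (p ∷ []) (q ∷ []) (λ z → +-monoˡ-≤ 0 (⟦⟧-mono (p⊆q z))))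

∁ᵇ : (Fin n → Bool) → Fin n → Bool
∁ᵇ p z = not (p z)

#-∁ᵇ : (p : Fin n → Bool) → # p + # (∁ᵇ p) ≤ n
#-∁ᵇ {n} p = begin
  # p + # (∁ᵇ p)             ≡⟨ cong (# p +_) (sym (+-identityʳ _)) ⟩
  total (p ∷ ∁ᵇ p ∷ [])      ≤⟨ total-mono (p ∷ ∁ᵇ p ∷ []) (all-members ∷ []) (λ z → pointwise (p z)) ⟩
  # (all-members {n}) + 0    ≡⟨ trans (+-identityʳ _) (#-all n) ⟩
  n                          ∎
  where
  open ≤-Reasoning
  pointwise : ∀ b → ⟦ b ⟧ + (⟦ not b ⟧ + 0) ≤ 1
  pointwise false = ≤-refl
  pointwise true  = ≤-refl

∁ᵇ-cut : (f : Coloring t n) {p : Fin n → Bool} {s : Fin t} → Monochromatic-cut f p s →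
         Monochromatic-cut f (∁ᵇ p) s
∁ᵇ-cut f cut u v u∉ v∈ = trans (color-sym f u v) (cut v u (not-false v∈) (not-true u∉))
  where
  not-false : ∀ {b} → not b ≡ false → b ≡ true
  not-false {true} _ = refl
  not-true : ∀ {b} → not b ≡ true → b ≡ false
  not-true {false} _ = refl

N-inside : (f : Coloring t n) {p : Fin n → Bool} {s c : Fin t} → Monochromatic-cut f p s → c ≢ s →
           ∀ {u} → p u ≡ true → ∀ z → N f c u z ≡ true → p z ≡ true
N-inside f {p} cut c≢s {u} u∈ z z∈N with p z in z∈?
... | true  = refl
... | false = contradiction (trans (sym (proj₂ (N-elim f u z z∈N))) (cut u z u∈ z∈?)) c≢s

N-irrefl : (f : Coloring t n) (c : Fin t) → ∀ x → N f c x x ≡ false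
N-irrefl f c x = ≢true⇒false (λ e → proj₁ (N-elim f x x e) refl)

#-insert : (q : Fin n → Bool) (z : Fin n) → q z ≡ false → suc (# q) ≤ # (q ∪ is z)
#-insert q z z∉q = begin
  suc (# q)                 ≡⟨ cong₂ _+_ (sym (#-is z)) (sym (+-identityʳ (# q))) ⟩
  total (is z ∷ q ∷ [])     ≤⟨ total-mono (is z ∷ q ∷ []) (q ∪ is z ∷ []) pointwise ⟩
  # (q ∪ is z) + 0          ≡⟨ +-identityʳ _ ⟩
  # (q ∪ is z)              ∎
  where
  open ≤-Reasoning
  pointwise : ∀ w → weight (is z ∷ q ∷ []) w ≤ weight (q ∪ is z ∷ []) w
  pointwise w with z ≟ w
  ... | yes refl rewrite z∉q = ≤-refl
  ... | no _ with q w
  ...   | true  = ≤-refl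
  ...   | false = ≤-refl

#-extend : (q p : Fin n → Bool) (zs : List (Fin n)) → AllPairs _≢_ zs →
           (∀ z → q z ≡ true → p z ≡ true) → All (λ z → p z ≡ true × q z ≡ false) zs →
           length zs + # q ≤ # p
#-extend q p [] _ q⊆p _ = #-mono q⊆p
#-extend {n} q p (z ∷ zs) (z≢zs ∷ zs≢) q⊆p ((z∈p , z∉q) ∷ zs∈) = begin
  suc (length zs + # q)       ≡⟨ +-suc (length zs) (# q) ⟨
  length zs + suc (# q)       ≤⟨ +-monoʳ-≤ (length zs) (#-insert q z z∉q) ⟩
  length zs + # (q ∪ is z)    ≤⟨ #-extend (q ∪ is z) p zs zs≢ q′⊆p (All.zipWith keep (z≢zs , zs∈)) ⟩
  # p                         ∎
  where
  open ≤-Reasoning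
  q′⊆p : ∀ w → (q ∪ is z) w ≡ true → p w ≡ true
  q′⊆p w e with ∨-true (q w) e
  ... | inj₁ w∈q = q⊆p w w∈q
  ... | inj₂ w≡z with does-true (z ≟ w) w≡z
  ...   | refl = z∈p
  keep : ∀ {w} → z ≢ w × (p w ≡ true × q w ≡ false) → p w ≡ true × (q ∪ is z) w ≡ false
  keep {w} (z≢w , w∈p , w∉q) = w∈p , trans (cong (_∨ is z w) w∉q) (dec-false (z ≟ w) z≢w)

-- Graphs on five vertices, for the bound on r(B₂, B₂)

distinct : (is : List (Fin n)) → Dec (AllPairs _≢_ is)
distinct = allPairs? (λ i j → ¬? (i ≟ j))

module _ (E : Fin 5 → Fin 5 → Set) (E? : ∀ i j → Dec (E i j))
  (E-sym : ∀ {i j} → E i j → E j i)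
  (degree≤1 : ∀ {i j k} → i ≢ j → i ≢ k → j ≢ k → E i j → E i k → ⊥)
  (no-book : ∀ {i j k l} → AllPairs _≢_ (i ∷ j ∷ k ∷ l ∷ []) →
             ¬ E i j → ¬ E i k → ¬ E i l → ¬ E j k → ¬ E j l → ⊥)
  where

  -- The edge ij uses up i and j, and k, l, m carry at most one edge, so one of these three is
  -- isolated. It forms a spine with i, and the other two of the three are the pages.
  matched : ∀ {i j k l m} → AllPairs _≢_ (i ∷ j ∷ k ∷ l ∷ m ∷ []) → E i j → ⊥
  matched {i} {j} {k} {l} {m}
    ((i≢j ∷ i≢k ∷ i≢l ∷ i≢m ∷ []) ∷ (j≢k ∷ j≢l ∷ j≢m ∷ []) ∷ (k≢l ∷ k≢m ∷ []) ∷ (l≢m ∷ []) ∷ [] ∷ []) ij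
    with E? k l | E? k m
  ... | yes kl | _ = no-book
    ((≢-sym i≢m ∷ ≢-sym k≢m ∷ ≢-sym l≢m ∷ []) ∷ (i≢k ∷ i≢l ∷ []) ∷ (k≢l ∷ []) ∷ [] ∷ [])
    (degree≤1 i≢j i≢m j≢m ij ∘ E-sym)
    (degree≤1 k≢l k≢m l≢m kl ∘ E-sym)
    (degree≤1 (≢-sym k≢l) l≢m k≢m (E-sym kl) ∘ E-sym)
    (degree≤1 i≢j i≢k j≢k ij)
    (degree≤1 i≢j i≢l j≢l ij)
  ... | no ¬kl | yes km = no-book
    ((≢-sym i≢l ∷ ≢-sym k≢l ∷ l≢m ∷ []) ∷ (i≢k ∷ i≢m ∷ []) ∷ (k≢m ∷ []) ∷ [] ∷ [])
    (degree≤1 i≢j i≢l j≢l ij ∘ E-sym)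
    (¬kl ∘ E-sym)
    (degree≤1 (≢-sym k≢m) (≢-sym l≢m) k≢l (E-sym km) ∘ E-sym)
    (degree≤1 i≢j i≢k j≢k ij)
    (degree≤1 i≢j i≢m j≢m ij)
  ... | no ¬kl | no ¬km = no-book
    ((≢-sym i≢k ∷ k≢l ∷ k≢m ∷ []) ∷ (i≢l ∷ i≢m ∷ []) ∷ (l≢m ∷ []) ∷ [] ∷ [])
    (degree≤1 i≢j i≢k j≢k ij ∘ E-sym)
    ¬kl
    ¬km
    (degree≤1 i≢j i≢l j≢l ij)
    (degree≤1 i≢j i≢m j≢m ij)

  -- A graph on five vertices of maximum degree at most one has an isolated vertex i, and i then
  -- spans with any other vertex the spine of a book with two pages in the complement.
  matching-on-five : ⊥
  matching-on-five with E? 0F 1F | E? 0F 2F | E? 0F 3F | E? 0F 4F | E? 1F 2F | E? 1F 3F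
  ... | yes e | _ | _ | _ | _ | _ = matched (from-yes (distinct (0F ∷ 1F ∷ 2F ∷ 3F ∷ 4F ∷ []))) e
  ... | _ | yes e | _ | _ | _ | _ = matched (from-yes (distinct (0F ∷ 2F ∷ 1F ∷ 3F ∷ 4F ∷ []))) e
  ... | _ | _ | yes e | _ | _ | _ = matched (from-yes (distinct (0F ∷ 3F ∷ 1F ∷ 2F ∷ 4F ∷ []))) e
  ... | _ | _ | _ | yes e | _ | _ = matched (from-yes (distinct (0F ∷ 4F ∷ 1F ∷ 2F ∷ 3F ∷ []))) e
  ... | _ | _ | _ | _ | yes e | _ = matched (from-yes (distinct (1F ∷ 2F ∷ 0F ∷ 3F ∷ 4F ∷ []))) e
  ... | _ | _ | _ | _ | _ | yes e = matched (from-yes (distinct (1F ∷ 3F ∷ 0F ∷ 2F ∷ 4F ∷ []))) e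
  ... | no ¬01 | no ¬02 | no ¬03 | _ | no ¬12 | no ¬13 =
    no-book (from-yes (distinct (0F ∷ 1F ∷ 2F ∷ 3F ∷ []))) ¬01 ¬02 ¬03 ¬12 ¬13

-- The small side of a cut

module SmallSide
  (f : Coloring 3 n)
  (union : ∀ {x y c} → x ≢ y → color f x y ≢ c → 8 ≤ # (N f c x ∪ N f c y))
  (p : Fin n → Bool) (s : Fin 3) (cut : Monochromatic-cut f p s) (small : # p ≤ 11)
  where

  -- The union of the `c`-neighbourhoods of `u` and `v` stays inside `p`, since only colour `s`
  -- crosses the cut, and it misses the four vertices of the book. Hence `p` would have at least 8 +
  -- 4 vertices.
  no-two-page-book : ∀ {c u v z₁ z₂} → c ≢ s → All (λ z → p z ≡ true) (u ∷ v ∷ z₁ ∷ z₂ ∷ []) →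
    AllPairs _≢_ (u ∷ v ∷ z₁ ∷ z₂ ∷ []) → color f u v ≢ c →
    color f u z₁ ≢ c → color f u z₂ ≢ c → color f v z₁ ≢ c → color f v z₂ ≢ c → ⊥
  no-two-page-book {c} {u} {v} {z₁} {z₂} c≢s (u∈ ∷ v∈ ∷ z₁∈ ∷ z₂∈ ∷ [])
    zs≢@((u≢v ∷ _) ∷ _) uv uz₁ uz₂ vz₁ vz₂ =
    <⇒≱ (s≤s small) (≤-trans (+-monoʳ-≤ 4 (union u≢v uv))
      (#-extend U p (u ∷ v ∷ z₁ ∷ z₂ ∷ []) zs≢ U⊆p
        ((u∈ , outside (λ e → proj₁ (N-elim f u u e) refl)
                       (λ e → uv (trans (color-sym f u v) (proj₂ (N-elim f v u e))))) ∷
         (v∈ , outside (uv ∘ proj₂ ∘ N-elim f u v) (λ e → proj₁ (N-elim f v v e) refl)) ∷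
         (z₁∈ , outside (uz₁ ∘ proj₂ ∘ N-elim f u z₁) (vz₁ ∘ proj₂ ∘ N-elim f v z₁)) ∷
         (z₂∈ , outside (uz₂ ∘ proj₂ ∘ N-elim f u z₂) (vz₂ ∘ proj₂ ∘ N-elim f v z₂)) ∷ [])))
    where
    U : Fin n → Bool
    U = N f c u ∪ N f c v
    U⊆p : ∀ z → U z ≡ true → p z ≡ true
    U⊆p z e with ∨-true (N f c u z) e
    ... | inj₁ z∈ = N-inside f cut c≢s u∈ z z∈
    ... | inj₂ z∈ = N-inside f cut c≢s v∈ z z∈
    outside : ∀ {z} → N f c u z ≢ true → N f c v z ≢ true → U z ≡ false
    outside {z} ∉u ∉v = ≢true⇒false (λ e → [ ∉u , ∉v ]′ (∨-true (N f c u z) e))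

  -- For a colour `c` other than `s` and that of xy, the union of the two `c`-neighbourhoods stays
  -- inside `p` and contains neither `x` nor `y`: 8 + 2 vertices.
  at-least-ten : ∀ {x y} → p x ≡ true → p y ≡ true → x ≢ y → 10 ≤ # p
  at-least-ten {x} {y} x∈ y∈ x≢y with third s (color f x y)
  ... | c , c≢s , c≢xy = ≤-trans (+-monoʳ-≤ 2 (union x≢y (≢-sym c≢xy)))
    (#-extend (N f c x ∪ N f c y) p (x ∷ y ∷ []) ((x≢y ∷ []) ∷ [] ∷ []) U⊆p
      ((x∈ , cong₂ _∨_ (N-irrefl f c x)
               (≢true⇒false (λ e → c≢xy (sym (trans (color-sym f x y) (proj₂ (N-elim f y x e))))))) ∷
       (y∈ , cong₂ _∨_ (≢true⇒false (λ e → c≢xy (sym (proj₂ (N-elim f x y e))))) (N-irrefl f c y)) ∷ []))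
    where
    U⊆p : ∀ z → (N f c x ∪ N f c y) z ≡ true → p z ≡ true
    U⊆p z e with ∨-true (N f c x z) e
    ... | inj₁ z∈ = N-inside f cut c≢s x∈ z z∈
    ... | inj₂ z∈ = N-inside f cut c≢s y∈ z z∈

  avoiding : Fin 3 → Fin n → Fin n → Bool
  avoiding c x z = p z ∧ (not (is x z) ∧ not (does (color f x z ≟ c)))

  avoiding-elim : ∀ {c x} z → avoiding c x z ≡ true → p z ≡ true × x ≢ z × color f x z ≢ c
  avoiding-elim {c} {x} z e with p z | x ≟ z | color f x z ≟ c
  ... | true | no x≢z | no xz≢c = refl , x≢z , xz≢c

  -- Join two of the five vertices when their edge is not of colour `c`. A vertex of degree two in
  -- this graph gives a two-page book avoiding `c` whose spine joins it to `x`; a book in the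
  -- complement has colour `c` throughout and so avoids `d`.
  five-avoiding : ∀ {c d x} → c ≢ s → d ≢ s → c ≢ d → p x ≡ true → ¬ (5 ≤ # (avoiding c x))
  five-avoiding {c} {d} {x} c≢s d≢s c≢d x∈ five with enumerate 5 (avoiding c x) five
  ... | φ , inj , φ∈ = matching-on-five
    (λ i j → color f (φ i) (φ j) ≢ c) (λ i j → ¬? (color f (φ i) (φ j) ≟ c))
    (λ {i} {j} e → e ∘ trans (color-sym f (φ i) (φ j)))
    (λ {i} {j} {k} i≢j i≢k j≢k ij ik → no-two-page-book c≢s (x∈ ∷ φ∈p i ∷ φ∈p j ∷ φ∈p k ∷ [])
      ((x≢φ i ∷ x≢φ j ∷ x≢φ k ∷ []) ∷ (i≢j ∘ inj ∷ i≢k ∘ inj ∷ []) ∷ (j≢k ∘ inj ∷ []) ∷ [] ∷ [])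
      (xφ≢c i) (xφ≢c j) (xφ≢c k) ij ik)
    (λ {i} {j} {k} {l} ≢s ij ik il jk jl → no-two-page-book d≢s (φ∈p i ∷ φ∈p j ∷ φ∈p k ∷ φ∈p l ∷ [])
      (AllPairs.map⁺ (AllPairs.map (_∘ inj) ≢s)) (not-d ij) (not-d ik) (not-d il) (not-d jk) (not-d jl))
    where
    φ∈p : ∀ i → p (φ i) ≡ true
    φ∈p i = proj₁ (avoiding-elim (φ i) (φ∈ i))
    x≢φ : ∀ i → x ≢ φ i
    x≢φ i = proj₁ (proj₂ (avoiding-elim (φ i) (φ∈ i)))
    xφ≢c : ∀ i → color f x (φ i) ≢ c
    xφ≢c i = proj₂ (proj₂ (avoiding-elim (φ i) (φ∈ i)))
    not-d : ∀ {u v} → ¬ (color f u v ≢ c) → color f u v ≢ d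
    not-d {u} {v} ¬≢c e = ¬≢c (λ e′ → c≢d (trans (sym e′) e))

  -- Every vertex of `p` other than `x` is joined to `x` in a colour different from `c` or from `d`.
  -- Each kind has at most four members, so the side has at most 1 + 4 + 4 vertices, while two
  -- distinct vertices force ten.
  singleton : ∀ {x y} → p x ≡ true → p y ≡ true → x ≡ y
  singleton {x} {y} x∈ y∈ with x ≟ y
  ... | yes x≡y = x≡y
  ... | no x≢y with third s s
  ...   | c , c≢s , _ with third s c
  ...     | d , d≢s , d≢c with 5 ℕ.≤? # (avoiding c x) | 5 ℕ.≤? # (avoiding d x)
  ...       | yes five | _        = ⊥-elim (five-avoiding c≢s d≢s (≢-sym d≢c) x∈ five)
  ...       | no _     | yes five = ⊥-elim (five-avoiding d≢s c≢s d≢c x∈ five)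
  ...       | no few₁  | no few₂  = contradiction (at-least-ten x∈ y∈ x≢y) (<⇒≱ (s≤s (begin
    # p
      ≡⟨ +-identityʳ (# p) ⟨
    total (p ∷ [])
      ≤⟨ total-mono (p ∷ []) (is x ∷ avoiding c x ∷ avoiding d x ∷ []) pointwise ⟩
    # (is x) + (# (avoiding c x) + (# (avoiding d x) + 0))
      ≤⟨ +-mono-≤ (≤-reflexive (#-is x)) (+-mono-≤ (s≤s⁻¹ (≰⇒> few₁)) (+-monoˡ-≤ 0 (s≤s⁻¹ (≰⇒> few₂)))) ⟩
    9 ∎)))
    where
    open ≤-Reasoning
    pointwise : ∀ z → weight (p ∷ []) z ≤ weight (is x ∷ avoiding c x ∷ avoiding d x ∷ []) z
    pointwise z with p z | x ≟ z | color f x z ≟ c | color f x z ≟ d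
    ... | false | _     | _     | _     = z≤n
    ... | true  | yes _ | _     | _     = s≤s z≤n
    ... | true  | no _  | no _  | _     = s≤s z≤n
    ... | true  | no _  | yes _ | no _  = s≤s z≤n
    ... | true  | no _  | yes e | yes e′ = contradiction (trans (sym e′) e) d≢c

-- Apex vertices

Apex : Coloring t n → Fin n → Fin t → Set
Apex f x s = ∀ z → x ≢ z → color f x z ≡ s

-- Of at most 23 vertices, one side of the cut has at most 11. That side is a single vertex, and all
-- its edges cross the cut.
cut⇒apex : n ≤ 23 → (f : Coloring 3 n) →
           (∀ {x y c} → x ≢ y → color f x y ≢ c → 8 ≤ # (N f c x ∪ N f c y)) →
           ∀ p s {x y} → p x ≡ true → p y ≡ false → Monochromatic-cut f p s → ∃₂ (Apex f)
cut⇒apex {n} n≤23 f union p s {x} {y} x∈ y∉ cut with # p ℕ.≤? 11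
... | yes small = x , s , λ z x≢z → cut x z x∈ (≢true⇒false (x≢z ∘ singleton x∈))
  where open SmallSide f union p s cut small
... | no large = y , s , λ z y≢z →
    ∁ᵇ-cut f cut y z y∈∁ (≢true⇒false (y≢z ∘ singleton y∈∁))
  where
  small : # (∁ᵇ p) ≤ 11
  small = +-cancelˡ-≤ 12 _ _ (≤-trans (+-monoˡ-≤ _ (≰⇒> large)) (≤-trans (#-∁ᵇ p) n≤23))
  open SmallSide f union (∁ᵇ p) s (∁ᵇ-cut f cut) small
  y∈∁ : ∁ᵇ p y ≡ true
  y∈∁ = cong not y∉

-- Only colour `s` crosses the cut, so both neighbourhoods stay on the side of `u`, and they are
-- disjoint from each other and from `u`.
side-size : (f : Coloring 3 n) {p : Fin n → Bool} {s c d : Fin 3} → Monochromatic-cut f p s →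
            c ≢ s → d ≢ s → c ≢ d → ∀ {u} → p u ≡ true → # (N f c u) + (# (N f d u) + 1) ≤ # p
side-size f {p} {s} {c} {d} cut c≢s d≢s c≢d {u} u∈ = begin
  # (N f c u) + (# (N f d u) + 1)
    ≡⟨ cong (λ k → # (N f c u) + (# (N f d u) + k)) (sym (trans (+-identityʳ _) (#-is u))) ⟩
  total (N f c u ∷ N f d u ∷ is u ∷ [])
    ≤⟨ total-mono (N f c u ∷ N f d u ∷ is u ∷ []) (p ∷ []) pointwise ⟩
  # p + 0
    ≡⟨ +-identityʳ _ ⟩
  # p ∎
  where
  open ≤-Reasoning
  pointwise : ∀ z → weight (N f c u ∷ N f d u ∷ is u ∷ []) z ≤ weight (p ∷ []) z
  pointwise z rewrite +-identityʳ ⟦ is u z ⟧ | +-identityʳ ⟦ p z ⟧ with p z in pz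
  ... | true = two-colours f c≢d u z
  ... | false rewrite ≢true⇒false {N f c u z} (λ e → true-false (N-inside f cut c≢s u∈ z e) pz)
                    | ≢true⇒false {N f d u z} (λ e → true-false (N-inside f cut d≢s u∈ z e) pz)
                    | dec-false (u ≟ z) (λ { refl → true-false u∈ pz }) = z≤n

-- Deletion of the apex

module WithoutApex
  (n≡22 : n ≡ 22) (f : Coloring 3 (suc n)) (gallai : IsGallai f)
  (union : ∀ {x y c} → x ≢ y → color f x y ≢ c → 8 ≤ # (N f c x ∪ N f c y))
  (x : Fin (suc n)) (s : Fin 3) (apex : Apex f x s)
  where

  W : Coloring 3 n
  W = restrict (punchIn x) f

  W-gallai : IsGallai W
  W-gallai = restrict-gallai (punchIn x) (punchIn-injective x _ _) f gallai

  apex-colour : ∀ u → color f x (punchIn x u) ≡ s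
  apex-colour u = apex (punchIn x u) (punchInᵢ≢i x u ∘ sym)

  N-W : ∀ {c} u z → N f c (punchIn x u) (punchIn x z) ≡ true → N W c u z ≡ true
  N-W u z e = let u≢z , uz≡c = N-elim f (punchIn x u) (punchIn x z) e
              in N-intro W (u≢z ∘ cong (punchIn x)) uz≡c

  -- The apex has no neighbour in a colour other than `s`, so the union bound for the apex and `u`
  -- is a bound on the degree of `u` alone.
  W-degree : ∀ {c} u → c ≢ s → 8 ≤ # (N W c u)
  W-degree {c} u c≢s = begin
    8                           ≤⟨ union (punchInᵢ≢i x u ∘ sym) (λ e → c≢s (trans (sym e) (apex-colour u))) ⟩
    # U                         ≡⟨ #-punchIn x U ⟩
    ⟦ U x ⟧ + # (U ∘ punchIn x) ≡⟨ cong (λ b → ⟦ b ⟧ + # (U ∘ punchIn x)) (≢true⇒false x∉U) ⟩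
    # (U ∘ punchIn x)           ≤⟨ #-mono U⊆N ⟩
    # (N W c u)                 ∎
    where
    open ≤-Reasoning
    U : Fin (suc n) → Bool
    U = N f c x ∪ N f c (punchIn x u)
    x∉U : U x ≢ true
    x∉U e with ∨-true (N f c x x) e
    ... | inj₁ e₁ = proj₁ (N-elim f x x e₁) refl
    ... | inj₂ e₂ = c≢s (trans (sym (proj₂ (N-elim f (punchIn x u) x e₂)))
                               (trans (color-sym f (punchIn x u) x) (apex-colour u)))
    U⊆N : ∀ z → U (punchIn x z) ≡ true → N W c u z ≡ true
    U⊆N z e with ∨-true (N f c x (punchIn x z)) e
    ... | inj₁ e₁ = contradiction (trans (sym (proj₂ (N-elim f x (punchIn x z) e₁))) (apex-colour z)) c≢s
    ... | inj₂ e₂ = N-W u z e₂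

  -- Deleting the apex removes at most one vertex from the union.
  W-union : ∀ {c u v} → u ≢ v → color W u v ≢ c → 7 ≤ # (N W c u ∪ N W c v)
  W-union {c} {u} {v} u≢v uv≢c = +-cancelˡ-≤ 1 _ _ (begin
    8                             ≤⟨ union (u≢v ∘ punchIn-injective x _ _) uv≢c ⟩
    # U                           ≡⟨ #-punchIn x U ⟩
    ⟦ U x ⟧ + # (U ∘ punchIn x)   ≤⟨ +-mono-≤ (⟦⟧≤1 (U x)) (#-mono U⊆) ⟩
    1 + # (N W c u ∪ N W c v)     ∎)
    where
    open ≤-Reasoning
    U : Fin (suc n) → Bool
    U = N f c (punchIn x u) ∪ N f c (punchIn x v)
    U⊆ : ∀ z → U (punchIn x z) ≡ true → (N W c u ∪ N W c v) z ≡ true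
    U⊆ z e with ∨-true (N f c (punchIn x u) (punchIn x z)) e
    ... | inj₁ e₁ = cong (_∨ N W c v z) (N-W u z e₁)
    ... | inj₂ e₂ = trans (cong (N W c u z ∨_) (N-W v z e₂)) (∨-zeroʳ _)

  W-union₈ : ∀ {c} u v → c ≢ s → 8 ≤ # (N W c u ∪ N W c v)
  W-union₈ {c} u v c≢s = ≤-trans (W-degree u c≢s) (#-mono (λ z e → cong (_∨ N W c v z) e))

  sides-size : (p : Fin n → Bool) → # p + # (∁ᵇ p) ≤ 22
  sides-size p = ≤-trans (#-∁ᵇ p) (≤-reflexive n≡22)

  -- If the cut has the apex colour, each side contains a vertex with its at least 8 neighbours in
  -- each of the two other colours, so at least 17 vertices. Otherwise the two sides contain at
  -- least 8 + 8 neighbours of `u` and `v` in colour `d`, at least 7 in colour `s`, and `u` and `v`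
  -- themselves, which makes 25.
  W-no-cut : ∀ p s′ {u v} → p u ≡ true → p v ≡ false → ¬ Monochromatic-cut W p s′
  W-no-cut p s′ {u} {v} u∈ v∉ cut with s′ ≟ s
  ... | yes refl with third s s
  ...   | c , c≢s , _ with third s c
  ...     | d , d≢s , d≢c = contradiction
    (≤-trans (+-mono-≤ (side u u∈ cut) (side v (cong not v∉) (∁ᵇ-cut W cut))) (sides-size p)) (from-no (34 ℕ.≤? 22))
    where
    side : ∀ {q} w → q w ≡ true → Monochromatic-cut W q s → 17 ≤ # q
    side w w∈ cut′ = ≤-trans (+-mono-≤ (W-degree w c≢s) (+-monoˡ-≤ 1 (W-degree w d≢s)))
                             (side-size W cut′ c≢s d≢s (≢-sym d≢c) w∈)
  W-no-cut p s′ {u} {v} u∈ v∉ cut | no s′≢s with third s s′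
  ...   | d , d≢s , d≢s′ = contradiction (begin
    25
      ≤⟨ +-monoʳ-≤ 18 (≤-trans (W-union u≢v uv≢s) (#-∪ (N W s u) (N W s v))) ⟩
    18 + (# (N W s u) + # (N W s v))
      ≡⟨ solve 2 (λ a b → con 18 :+ (a :+ b) := (con 8 :+ (a :+ con 1)) :+ (con 8 :+ (b :+ con 1)))
               refl (# (N W s u)) (# (N W s v)) ⟩
    (8 + (# (N W s u) + 1)) + (8 + (# (N W s v) + 1))
      ≤⟨ +-mono-≤ (side u u∈ cut) (side v (cong not v∉) (∁ᵇ-cut W cut)) ⟩
    # p + # (∁ᵇ p)
      ≤⟨ sides-size p ⟩
    22 ∎) (from-no (25 ℕ.≤? 22))
    where
    open ≤-Reasoning
    open +-*-Solver
    side : ∀ {q} w → q w ≡ true → Monochromatic-cut W q s′ → 8 + (# (N W s w) + 1) ≤ # q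
    side w w∈ cut′ = ≤-trans (+-monoˡ-≤ _ (W-degree w d≢s)) (side-size W cut′ d≢s′ (≢-sym s′≢s) d≢s w∈)
    uv≢s : color W u v ≢ s
    uv≢s e = s′≢s (trans (sym (cut u v u∈ v∉)) e)
    u≢v : u ≢ v
    u≢v refl = true-false u∈ v∉

  below : ∀ k {b} → k * 22 < b → k * n < b
  below k {b} = subst (λ n → k * n < b) (sym n≡22)

  -- The weaker bound 7 goes to `T` if the disconnected colour is the apex colour, and to `S`
  -- otherwise. Since S + T = 15 both times, the path bound is 3 · 22 < 8 + 4 · 15.
  impossible : ⊥
  impossible with disconnected-colour (subst (2 ≤_) (sym n≡22) (s≤s (s≤s z≤n))) W W-gallai
  ... | t , disconnected with t ≟ s
  ...   | yes refl = Partition.connected-colour W W-gallai t 8 7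
    W-union
    (λ {u} {v} _ _ c≢s → W-union₈ u v c≢s)
    W-no-cut (below 3 (from-yes (66 ℕ.<? 68))) (below 2 (from-yes (44 ℕ.<? 45)))
    (subst (_< 25) (sym n≡22) (from-yes (22 ℕ.<? 25))) disconnected
  ...   | no t≢s = Partition.connected-colour W W-gallai t 7 8
    (λ {u} {v} _ _ → W-union₈ u v t≢s)
    (λ u≢v uv≡t c≢t → W-union u≢v (λ e → c≢t (trans (sym e) uv≡t)))
    W-no-cut (below 3 (from-yes (66 ℕ.<? 68))) (below 2 (from-yes (44 ℕ.<? 50)))
    (subst (_< 28) (sym n≡22) (from-yes (22 ℕ.<? 28))) disconnected

-- Books

pages : Coloring t n → Fin t → Fin n → Fin n → Fin n → Bool
pages f c x y z =
  (not (is x z) ∧ not (is y z)) ∧ (not (does (color f x z ≟ c)) ∧ not (does (color f y z ≟ c)))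

pages-elim : (f : Coloring t n) {c : Fin t} → ∀ {x y} z → pages f c x y z ≡ true →
             (x ≢ z × y ≢ z) × color f x z ≢ c × color f y z ≢ c
pages-elim f {c} {x} {y} z e with x ≟ z | y ≟ z | color f x z ≟ c | color f y z ≟ c
... | no x≢z | no y≢z | no xz≢c | no yz≢c = (x≢z , y≢z) , xz≢c , yz≢c

pages-intro : (f : Coloring t n) {c : Fin t} → ∀ {x y} z → x ≢ z → y ≢ z → color f x z ≢ c →
              color f y z ≢ c → pages f c x y z ≡ true
pages-intro f {c} {x} {y} z x≢z y≢z xz≢c yz≢c
  rewrite dec-false (x ≟ z) x≢z | dec-false (y ≟ z) y≢z
        | dec-false (color f x z ≟ c) xz≢c | dec-false (color f y z ≟ c) yz≢c = refl

-- A vertex off the spine that is not a page sends colour `c` to an end of the spine, so few pages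
-- force a large union of neighbourhoods.
pages-or-union : (f : Coloring t n) (c : Fin t) (x y : Fin n) →
                 n ≤ 2 + (# (N f c x ∪ N f c y) + # (pages f c x y))
pages-or-union {n = n} f c x y = begin
  n                                               ≡⟨ trans (+-identityʳ _) (#-all n) ⟨
  total (all-members {n} ∷ [])                    ≤⟨ total-mono (all-members ∷ []) (is x ∷ is y ∷ U ∷ pages f c x y ∷ []) pointwise ⟩
  total (is x ∷ is y ∷ U ∷ pages f c x y ∷ [])
    ≡⟨ cong₂ (λ a b → a + (b + (# U + (# (pages f c x y) + 0)))) (#-is x) (#-is y) ⟩
  2 + (# U + (# (pages f c x y) + 0))             ≡⟨ cong (λ k → 2 + (# U + k)) (+-identityʳ _) ⟩
  2 + (# U + # (pages f c x y))                   ∎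
  where
  open ≤-Reasoning
  U : Fin n → Bool
  U = N f c x ∪ N f c y
  pointwise : ∀ z → weight (all-members ∷ []) z ≤ weight (is x ∷ is y ∷ U ∷ pages f c x y ∷ []) z
  pointwise z with x ≟ z | y ≟ z | color f x z ≟ c | color f y z ≟ c
  ... | yes _ | _     | _     | _     = s≤s z≤n
  ... | no _  | yes _ | _     | _     = s≤s z≤n
  ... | no _  | no _  | yes _ | _     = s≤s z≤n
  ... | no _  | no _  | no _  | yes _ = s≤s z≤n
  ... | no _  | no _  | no _  | no _  = s≤s z≤n

∣∁⁅c⁆∣≤2 : (c : Fin 3) → ∣ ∁ ⁅ c ⁆ ∣ ≤ 2
∣∁⁅c⁆∣≤2 c = ≤-reflexive (trans (∣∁p∣≡n∸∣p∣ ⁅ c ⁆) (cong (3 ℕ.∸_) (∣⁅x⁆∣≡1 c)))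

-- With three colours, a subgraph that avoids `c` uses colours from the two-element complement of
-- `c` only.
pages⇒book : (f : Coloring 3 n) {x y : Fin n} {c : Fin 3} → x ≢ y → color f x y ≢ c →
             ∀ k → k ≤ # (pages f c x y) → ContainsCopyInAtMost 2 (Book k) f
pages⇒book {n} f {x} {y} {c} x≢y xy≢c k k≤pages =
  φ , inj , ∁ ⁅ c ⁆ , ∣∁⁅c⁆∣≤2 c , λ u v uv → x∉p⇒x∈∁p (avoids-c u v uv ∘ x∈⁅y⁆⇒x≡y c)
  where
  enumeration = enumerate k (pages f c x y) k≤pages
  ψ = proj₁ enumeration
  ψ-inj = proj₁ (proj₂ enumeration)

  page : ∀ i → (x ≢ ψ i × y ≢ ψ i) × color f x (ψ i) ≢ c × color f y (ψ i) ≢ c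
  page i = pages-elim f (ψ i) (proj₂ (proj₂ enumeration) i)

  φ : Vertex (Book k) → Fin n
  φ (inj₁ 0F) = x
  φ (inj₁ 1F) = y
  φ (inj₂ i)  = ψ i

  inj : Injective _≡_ _≡_ φ
  inj {inj₁ 0F} {inj₁ 0F} _ = refl
  inj {inj₁ 0F} {inj₁ 1F} e = contradiction e x≢y
  inj {inj₁ 1F} {inj₁ 0F} e = contradiction (sym e) x≢y
  inj {inj₁ 1F} {inj₁ 1F} _ = refl
  inj {inj₁ 0F} {inj₂ j}  e = contradiction e (proj₁ (proj₁ (page j)))
  inj {inj₁ 1F} {inj₂ j}  e = contradiction e (proj₂ (proj₁ (page j)))
  inj {inj₂ i}  {inj₁ 0F} e = contradiction (sym e) (proj₁ (proj₁ (page i)))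
  inj {inj₂ i}  {inj₁ 1F} e = contradiction (sym e) (proj₂ (proj₁ (page i)))
  inj {inj₂ i}  {inj₂ j}  e = cong inj₂ (ψ-inj e)

  avoids-c : ∀ u v → Adj (Book k) u v → color f (φ u) (φ v) ≢ c
  avoids-c (inj₁ 0F) (inj₁ 0F) uv = contradiction refl uv
  avoids-c (inj₁ 0F) (inj₁ 1F) _ = xy≢c
  avoids-c (inj₁ 1F) (inj₁ 0F) _ = xy≢c ∘ trans (color-sym f x y)
  avoids-c (inj₁ 1F) (inj₁ 1F) uv = contradiction refl uv
  avoids-c (inj₁ 0F) (inj₂ j) _ = proj₁ (proj₂ (page j))
  avoids-c (inj₁ 1F) (inj₂ j) _ = proj₂ (proj₂ (page j))
  avoids-c (inj₂ i) (inj₁ 0F) _ = proj₁ (proj₂ (page i)) ∘ trans (color-sym f x (ψ i))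
  avoids-c (inj₂ i) (inj₁ 1F) _ = proj₂ (proj₂ (page i)) ∘ trans (color-sym f y (ψ i))

-- The upper bound

arrows : n ≡ 22 → GallaiArrows 3 2 (Book 14) (suc n)
arrows {n} n≡22 f gallai
  with any? (λ x → any? (λ y → any? (λ c →
         ¬? (x ≟ y) ×-dec ¬? (color f x y ≟ c) ×-dec 14 ℕ.≤? # (pages f c x y))))
... | yes (x , y , c , x≢y , xy≢c , enough) = pages⇒book f x≢y xy≢c 14 enough
-- Without a book, unions of neighbourhoods have at least 8 vertices. This excludes cuts by way of
-- the apex, and the component argument then applies with `S` and `T` both equal to 8.
... | no none with disconnected-colour (subst (λ n → 2 ≤ suc n) (sym n≡22) (s≤s (s≤s z≤n))) f gallai
...   | t , disconnected = ⊥-elim (Partition.connected-colour f gallai t 8 8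
    union
    (λ x≢y xy≡t c≢t → union x≢y (λ e → c≢t (trans (sym e) xy≡t)))
    no-cut
    (subst (λ n → 3 * suc n < 72) (sym n≡22) (from-yes (69 ℕ.<? 72)))
    (subst (λ n → 2 * suc n < 50) (sym n≡22) (from-yes (46 ℕ.<? 50)))
    (subst (λ n → suc n < 28) (sym n≡22) (from-yes (23 ℕ.<? 28)))
    disconnected)
  where
  union : ∀ {x y c} → x ≢ y → color f x y ≢ c → 8 ≤ # (N f c x ∪ N f c y)
  -- Two ends of the spine and at most 13 pages account for 15 of the 23 vertices; the other 8 lie
  -- in the union.
  union {x} {y} {c} x≢y xy≢c = +-cancelˡ-≤ 15 _ _ (begin
    23                             ≡⟨ cong suc n≡22 ⟨
    suc n                          ≤⟨ pages-or-union f c x y ⟩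
    2 + (# U + # (pages f c x y))  ≤⟨ +-monoʳ-≤ 2 (+-monoʳ-≤ (# U) few) ⟩
    2 + (# U + 13)                 ≡⟨ cong (2 +_) (+-comm (# U) 13) ⟩
    15 + # U                       ∎)
    where
    open ≤-Reasoning
    U : Fin (suc n) → Bool
    U = N f c x ∪ N f c y
    few : # (pages f c x y) ≤ 13
    few = s≤s⁻¹ (≰⇒> (λ enough → none (x , y , c , x≢y , xy≢c , enough)))

  no-cut : ∀ p s {x y} → p x ≡ true → p y ≡ false → ¬ Monochromatic-cut f p s
  no-cut p s x∈ y∉ cut with cut⇒apex (≤-reflexive (cong suc n≡22)) f union p s x∈ y∉ cut
  ... | a , s′ , apex = WithoutApex.impossible n≡22 f gallai union a s′ apex

-- The lower bound

-- Colour 0 inside a class, colour 1 along the pentagon 0-1-2-3-4-0 and colour 2 along its complement.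
pentagon : Fin 5 → Fin 5 → Fin 3
pentagon i j with ∣ toℕ i - toℕ j ∣
... | 0 = 0F
... | 1 = 1F
... | 4 = 1F
... | _ = 2F

pentagon-sym : ∀ i j → pentagon i j ≡ pentagon j i
pentagon-sym i j rewrite ∣-∣-comm (toℕ i) (toℕ j) = refl

abstract
  -- A rainbow triple would use colour 0 and hence repeat a class, but then its two other edges have
  -- the same colour.
  pentagon-gallai : ∀ i j k → ¬ (pentagon i j ≢ pentagon i k × pentagon i j ≢ pentagon j k ×
                                 pentagon i k ≢ pentagon j k)
  pentagon-gallai = from-yes (all? {5} λ i → all? {5} λ j → all? {5} λ k →
    ¬? (¬? (pentagon i j ≟ pentagon i k) ×-dec ¬? (pentagon i j ≟ pentagon j k)
        ×-dec ¬? (pentagon i k ≟ pentagon j k)))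

class : Fin 21 → Fin 5
class x = toℕ x mod 5

-- An apex joined in colour 0 to a pentagon blown up to cliques of colour 0 of sizes 5, 4, 4, 4, 4.
extremal : Coloring 3 22
extremal = record { color = colour ; color-sym = colour-sym }
  where
  colour : Fin 22 → Fin 22 → Fin 3
  colour zero    _       = 0F
  colour (suc _) zero    = 0F
  colour (suc x) (suc y) = pentagon (class x) (class y)

  colour-sym : ∀ x y → colour x y ≡ colour y x
  colour-sym zero    zero    = refl
  colour-sym zero    (suc _) = refl
  colour-sym (suc _) zero    = refl
  colour-sym (suc x) (suc y) = pentagon-sym (class x) (class y)

extremal-gallai : IsGallai extremal
extremal-gallai zero    _       _       (_ , xy≢xz , _)     = xy≢xz refl
extremal-gallai (suc _) zero    _       (_ , _ , xy≢yz , _) = xy≢yz refl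
extremal-gallai (suc _) (suc _) zero    (_ , _ , _ , xz≢yz) = xz≢yz refl
extremal-gallai (suc x) (suc y) (suc z) (_ , rainbow)       =
  pentagon-gallai (class x) (class y) (class z) rainbow

abstract
  -- Decided by exhaustion. The value 13 is attained when `c` is colour 0 and the spine joins two
  -- classes of size 4: the pages are then the 13 vertices of the other three classes.
  extremal-pages : ∀ x y c → x ≢ y → color extremal x y ≢ c → # (pages extremal c x y) ≤ 13
  extremal-pages = from-yes (all? {22} λ x → all? {22} λ y → all? {3} λ c →
    ¬? (x ≟ y) →-dec (¬? (color extremal x y ≟ c) →-dec (# (pages extremal c x y) ℕ.≤? 13)))

missing-colour : (C : Subset 3) → ∣ C ∣ ≤ 2 → ∃[ c ] ¬ (c ∈ C)
missing-colour C ∣C∣≤2 with any? (λ c → ¬? (c ∈? C))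
... | yes missing = missing
... | no none = contradiction
  (p⊆q⇒∣p∣≤∣q∣ {p = ⊤} {q = C} (λ {c} _ → decidable-stable (c ∈? C) (λ c∉ → none (c , c∉)))) (<⇒≱ (s≤s ∣C∣≤2))

-- Smaller complete graphs inherit the extremal colouring by restriction. A book using two colours
-- avoids a third one, and its 14 pages would all be counted by `pages` for that colour.
lower-bound : ∀ q → q ≤ 22 → ¬ GallaiArrows 3 2 (Book 14) q
lower-bound q q≤22 q-arrows
  with q-arrows (restrict (λ x → inject≤ x q≤22) extremal)
              (restrict-gallai (λ x → inject≤ x q≤22) (inject≤-injective q≤22 q≤22 _ _) extremal extremal-gallai)
... | φ , φ-inj , C , ∣C∣≤2 , inside with missing-colour C ∣C∣≤2
... | c , c∉C = <⇒≱ (s≤s (extremal-pages x y c (λ e → spine≢ (inj e)) (avoids-c _ _ (λ ()))))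
  (injection⇒≤# (pages extremal c x y) (ψ ∘ inj₂) (λ e → inj₂-injective (inj e)) λ i →
     pages-intro extremal (ψ (inj₂ i)) (λ e → page≢ (inj e)) (λ e → page≢ (inj e))
       (avoids-c _ _ tt) (avoids-c _ _ tt))
  where
  ψ : Vertex (Book 14) → Fin 22
  ψ u = inject≤ (φ u) q≤22

  x = ψ (inj₁ 0F)
  y = ψ (inj₁ 1F)

  inj : ∀ {u v} → ψ u ≡ ψ v → u ≡ v
  inj e = φ-inj (inject≤-injective q≤22 q≤22 _ _ e)

  spine≢ : _≢_ {A = Fin 2 ⊎ Fin 14} (inj₁ 0F) (inj₁ 1F)
  spine≢ ()

  page≢ : ∀ {i : Fin 2} {j : Fin 14} → inj₁ i ≢ inj₂ j
  page≢ ()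

  avoids-c : ∀ u v → Adj (Book 14) u v → color extremal (ψ u) (ψ v) ≢ c
  avoids-c u v uv refl = c∉C (inside u v uv)

theorem4p10 : IsWeakenedGallaiRamsey 3 2 (Book 14) 23
theorem4p10 = arrows refl , λ q q-arrows → ≮⇒≥ (λ q<23 → lower-bound q (s≤s⁻¹ q<23) q-arrows)
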